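{- Every nine-triangle dissection $D$ of the unit square consisting of one cap having an entire side of the square as a side and an eight-step two-rail zig-zag in the complementary trapezoid satisfies $$R(D)>\frac1{3500}.$$ Here the triangle areas are arbitrary positive numbers and all $2^8=256$ direction sequences of the zig-zag are allowed; no balance condition (equal numbers of steps on the two rails) and no two-level condition (only two distinct area values) is imposed.
   Context: A dissection of the unit square into $n$ triangles is a collection of $n$ nondegenerate (positive-area) closed triangles with pairwise disjoint interiors whose union is the square; T-junctions are allowed. If $D$ has triangle areas $a_1,\dots,a_n$, its area range is $R(D)=\max_i a_i-\min_i a_i$. Single-cap two-rail family (up to a symmetry of the square). Let $P=(0,0)$, $Q=(1,0)$, $T=(1,1)$, $S=(0,1)$. The cap is the triangle $STR_c$ with $R_c=(1,1-2c)$, where $c\in(0,1/2)$ is its area. The complementary trapezoid $PQR_cS$ has a lower rail, the segment $PQ$, and an upper rail, the segment $SR_c$. An eight-step two-rail zig-zag with direction sequence $s=(s_1,\dots,s_8)\in\{ -1,+1\}^8$ is a cutting of this trapezoid into eight triangles of the following form: start with $p_0=P$ on the lower rail and $u_0=S$ on the upper rail; at step $i$, if $s_i=-1$ choose $p_i$ on the lower rail strictly beyond $p_{i-1}$ in the direction of $Q$, put $u_i=u_{i-1}$, and the $i$-th triangle is $p_{i-1}p_iu_{i-1}$; if $s_i=+1$ choose $u_i$ on the upper rail strictly beyond $u_{i-1}$ in the direction of $R_c$, put $p_i=p_{i-1}$, and the $i$-th triangle is $p_{i-1}u_{i-1}u_i$; the zig-zag must end with $p_8=Q$ and $u_8=R_c$.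 The nine triangles of the dissection are the cap and these eight triangles. -}

module Defs where

open import Data.Bool using (Bool; if_then_else_)
open import Data.Empty using (⊥)
open import Data.Fin using (Fin; zero; suc; inject₁; fromℕ)
open import Data.Fin.Permutation using (Permutation′; _⟨$⟩ʳ_)
open import Data.Fin.Patterns using (0F; 1F; 2F)
open import Data.Nat as ℕ using (ℕ; suc)
import Data.Nat.Properties as ℕ
open import Data.Product using (_×_; _,_; Σ-syntax; ∃-syntax)
open import Data.Rational as ℚ using (ℚ; 0ℚ; 1ℚ; ½)
import Data.Rational.Properties as ℚ
open import Data.Rational.Solver using (module +-*-Solver)
open import Data.Sign as Sign using (Sign)
open import Data.Sum using (inj₁; inj₂)
open import Data.Vec.Functional using (Vector; _∷_; []; foldr; head; tail; map)
open import Function using (_∘_)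
open import Relation.Binary.PropositionalEquality
  using (_≡_; _≢_; refl; sym; trans; cong; subst; subst₂)
open import Relation.Nullary using (¬_)

-- The reals are Cauchy sequences of rationals with a modulus, used as a
-- setoid: equality of reals is _≈_, not _≡_.
IsCauchy : (ℕ → ℚ) → Set
IsCauchy f = ∀ ε → 0ℚ ℚ.< ε →
  Σ[ N ∈ ℕ ] (∀ m n → N ℕ.≤ m → N ℕ.≤ n → ℚ.∣ f m ℚ.- f n ∣ ℚ.≤ ε)

record ℝ : Set where
  constructor mkℝ
  field
    seq    : ℕ → ℚ
    cauchy : IsCauchy seq

open ℝ public

Eventually : (ℕ → Set) → Set
Eventually P = Σ[ N ∈ ℕ ] (∀ n → N ℕ.≤ n → P n)

infix 4 _≈_ _≤_ _<_

_≈_ : ℝ → ℝ → Set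
x ≈ y = ∀ ε → 0ℚ ℚ.< ε → Eventually (λ n → ℚ.∣ seq x n ℚ.- seq y n ∣ ℚ.≤ ε)

_≤_ : ℝ → ℝ → Set
x ≤ y = ∀ ε → 0ℚ ℚ.< ε → Eventually (λ n → seq x n ℚ.≤ seq y n ℚ.+ ε)

_<_ : ℝ → ℝ → Set
x < y = ∃[ ε ] (0ℚ ℚ.< ε × Eventually (λ n → seq x n ℚ.+ ε ℚ.≤ seq y n))

private
  dist : ℚ → ℚ → ℚ
  dist p q = ℚ.∣ p ℚ.- q ∣

  ≤∣∣ : ∀ p → p ℚ.≤ ℚ.∣ p ∣
  ≤∣∣ p with ℚ.≤-total 0ℚ p
  ... | inj₁ 0≤p = ℚ.≤-reflexive (sym (ℚ.0≤p⇒∣p∣≡p 0≤p))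
  ... | inj₂ p≤0 = ℚ.≤-trans p≤0 (ℚ.0≤∣p∣ p)

  dist-sym : ∀ p q → dist p q ≡ dist q p
  dist-sym p q = trans (sym (ℚ.∣-p∣≡∣p∣ (p ℚ.- q))) (cong ℚ.∣_∣
    (solve 2 (λ a b → :- (a :- b) := b :- a) refl p q))
    where open +-*-Solver

  ≤+dist : ∀ p q → p ℚ.≤ q ℚ.+ dist p q
  ≤+dist p q = subst (ℚ._≤ q ℚ.+ dist p q)
    (solve 2 (λ a b → b :+ (a :- b) := a) refl p q)
    (ℚ.+-monoʳ-≤ q (≤∣∣ (p ℚ.- q)))
    where open +-*-Solver

  dist≤ : ∀ p q d → p ℚ.≤ q ℚ.+ d → q ℚ.≤ p ℚ.+ d → dist p q ℚ.≤ d
  dist≤ p q d p≤ q≤ with ℚ.∣p∣≡p∨∣p∣≡-p (p ℚ.- q)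
  ... | inj₁ e = subst₂ ℚ._≤_ (sym e)
    (solve 2 (λ b d → (b :+ d) :- b := d) refl q d) (ℚ.+-monoˡ-≤ (ℚ.- q) p≤)
    where open +-*-Solver
  ... | inj₂ e = subst₂ ℚ._≤_
    (trans (solve 2 (λ a b → b :- a := :- (a :- b)) refl p q) (sym e))
    (solve 2 (λ a d → (a :+ d) :- a := d) refl p d) (ℚ.+-monoˡ-≤ (ℚ.- p) q≤)
    where open +-*-Solver

  Lipschitz₁ : (ℚ → ℚ) → Set
  Lipschitz₁ g = ∀ p p′ → dist (g p) (g p′) ℚ.≤ dist p p′

  Lipschitz₂ : (ℚ → ℚ → ℚ) → Set
  Lipschitz₂ g = ∀ p q p′ q′ →
    dist (g p q) (g p′ q′) ℚ.≤ dist p p′ ℚ.+ dist q q′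

  lift₁ : (g : ℚ → ℚ) → Lipschitz₁ g → ℝ → ℝ
  lift₁ g g-lip x = mkℝ (g ∘ seq x) λ ε ε>0 →
    let N , close = cauchy x ε ε>0 in
    N , λ m n N≤m N≤n → ℚ.≤-trans (g-lip _ _) (close m n N≤m N≤n)

  half-pos : ∀ {ε} → 0ℚ ℚ.< ε → 0ℚ ℚ.< ½ ℚ.* ε
  half-pos {ε} ε>0 =
    subst (ℚ._< ½ ℚ.* ε) (ℚ.*-zeroʳ ½) (ℚ.*-monoʳ-<-pos ½ ε>0)

  half+half : ∀ ε → ½ ℚ.* ε ℚ.+ ½ ℚ.* ε ≡ ε
  half+half ε = trans (sym (ℚ.*-distribʳ-+ ε ½ ½)) (ℚ.*-identityˡ ε)

  lift₂ : (g : ℚ → ℚ → ℚ) → Lipschitz₂ g → ℝ → ℝ → ℝ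
  lift₂ g g-lip x y = mkℝ (λ n → g (seq x n) (seq y n)) λ ε ε>0 →
    let M , closeˣ = cauchy x (½ ℚ.* ε) (half-pos ε>0)
        N , closeʸ = cauchy y (½ ℚ.* ε) (half-pos ε>0)
    in M ℕ.⊔ N , λ m n ≤m ≤n → ℚ.≤-trans (g-lip _ _ _ _)
         (subst (_ ℚ.≤_) (half+half ε) (ℚ.+-mono-≤
           (closeˣ m n (ℕ.m⊔n≤o⇒m≤o M N ≤m) (ℕ.m⊔n≤o⇒m≤o M N ≤n))
           (closeʸ m n (ℕ.m⊔n≤o⇒n≤o M N ≤m) (ℕ.m⊔n≤o⇒n≤o M N ≤n))))

  neg-lip : Lipschitz₁ (λ p → ℚ.- p)
  neg-lip p p′ = ℚ.≤-reflexive (trans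
    (cong ℚ.∣_∣ (solve 2 (λ a b → :- a :- :- b := b :- a) refl p p′))
    (dist-sym p′ p))
    where open +-*-Solver

  abs-lip : Lipschitz₁ ℚ.∣_∣
  abs-lip p p′ = dist≤ ℚ.∣ p ∣ ℚ.∣ p′ ∣ _ (half p p′)
    (subst (λ d → ℚ.∣ p′ ∣ ℚ.≤ ℚ.∣ p ∣ ℚ.+ d) (dist-sym p′ p) (half p′ p))
    where
    open +-*-Solver
    half : ∀ a b → ℚ.∣ a ∣ ℚ.≤ ℚ.∣ b ∣ ℚ.+ dist a b
    half a b = subst (λ c → ℚ.∣ c ∣ ℚ.≤ ℚ.∣ b ∣ ℚ.+ dist a b)
      (solve 2 (λ a b → b :+ (a :- b) := a) refl a b)
      (ℚ.∣p+q∣≤∣p∣+∣q∣ b (a ℚ.- b))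

  +-lip : Lipschitz₂ ℚ._+_
  +-lip p q p′ q′ = subst (λ c → ℚ.∣ c ∣ ℚ.≤ dist p p′ ℚ.+ dist q q′)
    (solve 4 (λ a b c d → (a :- c) :+ (b :- d) := (a :+ b) :- (c :+ d))
      refl p q p′ q′)
    (ℚ.∣p+q∣≤∣p∣+∣q∣ (p ℚ.- p′) (q ℚ.- q′))
    where open +-*-Solver

  -- An operation whose value moves up by at most d when both arguments do.
  lip-from-≤ : ∀ g →
    (∀ p q p′ q′ d → p ℚ.≤ p′ ℚ.+ d → q ℚ.≤ q′ ℚ.+ d → g p q ℚ.≤ g p′ q′ ℚ.+ d) →
    Lipschitz₂ g
  lip-from-≤ g up p q p′ q′ = dist≤ _ _ _
    (up p q p′ q′ _ (boundˡ p p′ (q ℚ.- q′)) (boundʳ q q′ (p ℚ.- p′)))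
    (up p′ q′ p q _
      (subst (λ e → p′ ℚ.≤ p ℚ.+ (e ℚ.+ dist q q′)) (dist-sym p′ p)
        (boundˡ p′ p (q ℚ.- q′)))
      (subst (λ e → q′ ℚ.≤ q ℚ.+ (dist p p′ ℚ.+ e)) (dist-sym q′ q)
        (boundʳ q′ q (p ℚ.- p′))))
    where
    weakenʳ : ∀ a b → a ℚ.≤ a ℚ.+ ℚ.∣ b ∣
    weakenʳ a b = subst (ℚ._≤ a ℚ.+ ℚ.∣ b ∣) (ℚ.+-identityʳ a)
      (ℚ.+-monoʳ-≤ a (ℚ.0≤∣p∣ b))
    boundˡ : ∀ a b c → a ℚ.≤ b ℚ.+ (dist a b ℚ.+ ℚ.∣ c ∣)
    boundˡ a b c = ℚ.≤-trans (≤+dist a b) (ℚ.+-monoʳ-≤ b (weakenʳ _ c))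
    boundʳ : ∀ a b c → a ℚ.≤ b ℚ.+ (ℚ.∣ c ∣ ℚ.+ dist a b)
    boundʳ a b c = ℚ.≤-trans (≤+dist a b) (ℚ.+-monoʳ-≤ b
      (subst (dist a b ℚ.≤_) (ℚ.+-comm (dist a b) ℚ.∣ c ∣) (weakenʳ _ c)))

  ⊔-lip : Lipschitz₂ ℚ._⊔_
  ⊔-lip = lip-from-≤ ℚ._⊔_ λ p q p′ q′ d p≤ q≤ → ℚ.⊔-lub
    (ℚ.≤-trans p≤ (ℚ.+-monoˡ-≤ d (ℚ.p≤p⊔q p′ q′)))
    (ℚ.≤-trans q≤ (ℚ.+-monoˡ-≤ d (ℚ.p≤q⊔p p′ q′)))

  ⊓-lip : Lipschitz₂ ℚ._⊓_
  ⊓-lip = lip-from-≤ ℚ._⊓_ λ p q p′ q′ d p≤ q≤ →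
    subst (p ℚ.⊓ q ℚ.≤_) (sym (ℚ.mono-≤-distrib-⊓ (ℚ.+-monoˡ-≤ d) p′ q′))
      (ℚ.⊓-glb (ℚ.≤-trans (ℚ.p⊓q≤p p q) p≤) (ℚ.≤-trans (ℚ.p⊓q≤q p q) q≤))

fromℚ : ℚ → ℝ
fromℚ q = mkℝ (λ _ → q) λ ε ε>0 → 0 , λ _ _ _ _ →
  subst (ℚ._≤ ε) (cong ℚ.∣_∣ (sym (ℚ.+-inverseʳ q))) (ℚ.<⇒≤ ε>0)

infixl 7 _*_
infixl 6 _+_ _-_
infix  8 -_

-_ : ℝ → ℝ
-_ = lift₁ (λ p → ℚ.- p) neg-lip

∣_∣ : ℝ → ℝ
∣_∣ = lift₁ ℚ.∣_∣ abs-lip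

_+_ _-_ _⊔_ _⊓_ : ℝ → ℝ → ℝ
_+_ = lift₂ ℚ._+_ +-lip
x - y = x + - y
_⊔_ = lift₂ ℚ._⊔_ ⊔-lip
_⊓_ = lift₂ ℚ._⊓_ ⊓-lip

private
  bounded : ∀ x → Σ[ N ∈ ℕ ] Σ[ B ∈ ℚ ]
    ℚ.Positive B × (∀ n → N ℕ.≤ n → ℚ.∣ seq x n ∣ ℚ.≤ B)
  bounded x =
    let N , close = cauchy x 1ℚ (ℚ.positive⁻¹ 1ℚ) in
    N , ℚ.∣ seq x N ∣ ℚ.+ 1ℚ ,
    ℚ.nonNeg+pos⇒pos ℚ.∣ seq x N ∣ {{ℚ.∣-∣-nonNeg (seq x N)}} 1ℚ ,
    λ n N≤n → subst (λ a → ℚ.∣ a ∣ ℚ.≤ ℚ.∣ seq x N ∣ ℚ.+ 1ℚ)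
      (solve 2 (λ a b → b :+ (a :- b) := a) refl (seq x n) (seq x N))
      (ℚ.≤-trans (ℚ.∣p+q∣≤∣p∣+∣q∣ (seq x N) (seq x n ℚ.- seq x N))
        (ℚ.+-monoʳ-≤ ℚ.∣ seq x N ∣ (close n N N≤n ℕ.≤-refl)))
    where open +-*-Solver

  *-dist : ∀ p q p′ q′ B C δ →
    ℚ.Positive B → ℚ.Positive C → ℚ.∣ p ∣ ℚ.≤ B → ℚ.∣ q′ ∣ ℚ.≤ C →
    dist p p′ ℚ.≤ δ → dist q q′ ℚ.≤ δ →
    dist (p ℚ.* q) (p′ ℚ.* q′) ℚ.≤ (B ℚ.+ C) ℚ.* δ
  *-dist p q p′ q′ B C δ B>0 C>0 ∣p∣≤B ∣q′∣≤C pp′ qq′ = begin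
    dist (p ℚ.* q) (p′ ℚ.* q′)
      ≡⟨ cong ℚ.∣_∣ (solve 4 (λ a b c d →
           a :* b :- c :* d := a :* (b :- d) :+ d :* (a :- c)) refl p q p′ q′) ⟩
    ℚ.∣ p ℚ.* (q ℚ.- q′) ℚ.+ q′ ℚ.* (p ℚ.- p′) ∣
      ≤⟨ ℚ.∣p+q∣≤∣p∣+∣q∣ (p ℚ.* (q ℚ.- q′)) (q′ ℚ.* (p ℚ.- p′)) ⟩
    ℚ.∣ p ℚ.* (q ℚ.- q′) ∣ ℚ.+ ℚ.∣ q′ ℚ.* (p ℚ.- p′) ∣
      ≤⟨ ℚ.+-mono-≤ (step p (q ℚ.- q′) B B>0 ∣p∣≤B qq′)
                    (step q′ (p ℚ.- p′) C C>0 ∣q′∣≤C pp′) ⟩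
    B ℚ.* δ ℚ.+ C ℚ.* δ
      ≡⟨ sym (ℚ.*-distribʳ-+ δ B C) ⟩
    (B ℚ.+ C) ℚ.* δ ∎
    where
    open ℚ.≤-Reasoning
    open +-*-Solver using (solve; _:=_; _:+_; _:*_; _:-_)
    step : ∀ a b A → ℚ.Positive A → ℚ.∣ a ∣ ℚ.≤ A → ℚ.∣ b ∣ ℚ.≤ δ →
           ℚ.∣ a ℚ.* b ∣ ℚ.≤ A ℚ.* δ
    step a b A A>0 a≤ b≤ = begin
      ℚ.∣ a ℚ.* b ∣          ≡⟨ ℚ.∣p*q∣≡∣p∣*∣q∣ a b ⟩
      ℚ.∣ a ∣ ℚ.* ℚ.∣ b ∣    ≤⟨ ℚ.*-monoʳ-≤-nonNeg ℚ.∣ b ∣ {{ℚ.∣-∣-nonNeg b}} a≤ ⟩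
      A ℚ.* ℚ.∣ b ∣          ≤⟨ ℚ.*-monoˡ-≤-nonNeg A {{ℚ.pos⇒nonNeg A {{A>0}}}} b≤ ⟩
      A ℚ.* δ                ∎

  *-cauchy : ∀ x y → IsCauchy (λ n → seq x n ℚ.* seq y n)
  *-cauchy x y ε ε>0 =
    let L , B , B>0 , x≤B = bounded x
        M , C , C>0 , y≤C = bounded y
        K>0 = ℚ.pos+pos⇒pos B {{B>0}} C {{C>0}}
        K≢0 = ℚ.pos⇒nonZero (B ℚ.+ C) {{K>0}}
        K⁻¹ = ℚ.1/_ (B ℚ.+ C) {{K≢0}}
        δ   = K⁻¹ ℚ.* ε
        δ>0 = subst (ℚ._< δ) (ℚ.*-zeroʳ K⁻¹)
                (ℚ.*-monoʳ-<-pos K⁻¹ {{ℚ.1/pos⇒pos (B ℚ.+ C) {{K>0}}}} ε>0)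
        Kδ≡ε = trans (sym (ℚ.*-assoc (B ℚ.+ C) K⁻¹ ε))
                 (trans (cong (ℚ._* ε) (ℚ.*-inverseʳ (B ℚ.+ C) {{K≢0}}))
                   (ℚ.*-identityˡ ε))
        N₁ , closeˣ = cauchy x δ δ>0
        N₂ , closeʸ = cauchy y δ δ>0
        bnd  = L ℕ.⊔ M
        near = N₁ ℕ.⊔ N₂
    in bnd ℕ.⊔ near , λ m n ≤m ≤n →
      let b≤m = ℕ.m⊔n≤o⇒m≤o bnd near ≤m
          b≤n = ℕ.m⊔n≤o⇒m≤o bnd near ≤n
          c≤m = ℕ.m⊔n≤o⇒n≤o bnd near ≤m
          c≤n = ℕ.m⊔n≤o⇒n≤o bnd near ≤n
      in subst (_ ℚ.≤_) Kδ≡ε (*-dist _ _ _ _ B C δ B>0 C>0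
           (x≤B m (ℕ.m⊔n≤o⇒m≤o L M b≤m)) (y≤C n (ℕ.m⊔n≤o⇒n≤o L M b≤n))
           (closeˣ m n (ℕ.m⊔n≤o⇒m≤o N₁ N₂ c≤m) (ℕ.m⊔n≤o⇒m≤o N₁ N₂ c≤n))
           (closeʸ m n (ℕ.m⊔n≤o⇒n≤o N₁ N₂ c≤m) (ℕ.m⊔n≤o⇒n≤o N₁ N₂ c≤n)))

_*_ : ℝ → ℝ → ℝ
x * y = mkℝ (λ n → seq x n ℚ.* seq y n) (*-cauchy x y)

0ℝ 1ℝ ½ℝ 2ℝ : ℝ
0ℝ = fromℚ 0ℚ
1ℝ = fromℚ 1ℚ
½ℝ = fromℚ ½
2ℝ = 1ℝ + 1ℝ

max min : ∀ {n} → Vector ℝ (suc n) → ℝ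
max v = foldr _⊔_ (head v) (tail v)
min v = foldr _⊓_ (head v) (tail v)

Point : Set
Point = ℝ × ℝ

infix 4 _≈ₚ_
_≈ₚ_ : Point → Point → Set
(x , y) ≈ₚ (x′ , y′) = x ≈ x′ × y ≈ y′

Region : Set₁
Region = Point → Set

UnitSquare : Region
UnitSquare (x , y) = (0ℝ ≤ x × x ≤ 1ℝ) × (0ℝ ≤ y × y ≤ 1ℝ)

-- Topological interior, with sup-norm balls.
Interior : Region → Region
Interior A (x , y) = ∃[ ε ] (0ℝ < ε ×
  (∀ x′ y′ → ∣ x′ - x ∣ < ε → ∣ y′ - y ∣ < ε → A (x′ , y′)))

Triangle : Set
Triangle = Vector Point 3

⟦_⟧ : Triangle → Region
⟦ T ⟧ z = Σ[ w ∈ Vector ℝ 3 ] ((∀ k → 0ℝ ≤ w k)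
  × (w 0F + w 1F + w 2F ≈ 1ℝ)
  × (combination w ≈ₚ z))
  where
  combination : Vector ℝ 3 → Point
  combination w =
    let (x₀ , y₀) = T 0F ; (x₁ , y₁) = T 1F ; (x₂ , y₂) = T 2F in
    w 0F * x₀ + w 1F * x₁ + w 2F * x₂ , w 0F * y₀ + w 1F * y₁ + w 2F * y₂

area : Triangle → ℝ
area T =
  let (x₀ , y₀) = T 0F ; (x₁ , y₁) = T 1F ; (x₂ , y₂) = T 2F in
  ½ℝ * ∣ (x₁ - x₀) * (y₂ - y₀) - (x₂ - x₀) * (y₁ - y₀) ∣

-- Constructively one cannot in general decide which of two adjacent closed
-- triangles contains a given point, so the covering condition asserts the
-- existence of a containing triangle in its double-negated (classical) form.
record Dissection (n : ℕ) : Set where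
  field
    triangle          : Vector Triangle n
    nondegenerate     : ∀ i → 0ℝ < area (triangle i)
    disjointInteriors : ∀ i j → i ≢ j → ∀ z →
      Interior ⟦ triangle i ⟧ z → Interior ⟦ triangle j ⟧ z → ⊥
    inside            : ∀ i z → ⟦ triangle i ⟧ z → UnitSquare z
    covers            : ∀ z → UnitSquare z → ¬ ¬ (∃[ i ] ⟦ triangle i ⟧ z)

open Dissection public

areaRange : ∀ {n} → Dissection (suc n) → ℝ
areaRange D = max areas - min areas
  where
  areas : Vector ℝ _
  areas = map area (triangle D)

-- Each of the eight symmetries is uniquely an optional exchange of the
-- coordinates followed by optional reflections x ↦ 1 - x and y ↦ 1 - y.
record Symmetry : Set where
  field
    swap flipX flipY : Bool

act : Symmetry → Point → Point
act σ (x , y) =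
  let (x′ , y′) = if swap then (y , x) else (x , y) in
  (if flipX then 1ℝ - x′ else x′) , (if flipY then 1ℝ - y′ else y′)
  where open Symmetry σ

along : Point → Point → ℝ → Point
along (x , y) (x′ , y′) t = x + t * (x′ - x) , y + t * (y′ - y)

Advance : Sign → (p u p′ u′ : ℝ) → Set
Advance Sign.- p u p′ u′ = p < p′ × u′ ≈ u
Advance Sign.+ p u p′ u′ = p′ ≈ p × u < u′

-- Rail points are recorded by the fraction of the rail already traversed.
record ZigZag (n : ℕ) : Set where
  field
    s        : Vector Sign n
    p u      : Vector ℝ (suc n)
    p-onRail : ∀ i → 0ℝ ≤ p i × p i ≤ 1ℝ
    u-onRail : ∀ i → 0ℝ ≤ u i × u i ≤ 1ℝ
    start    : p zero ≈ 0ℝ × u zero ≈ 0ℝ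
    advance  : ∀ i →
      Advance (s i) (p (inject₁ i)) (u (inject₁ i)) (p (suc i)) (u (suc i))
    finish   : p (fromℕ n) ≈ 1ℝ × u (fromℕ n) ≈ 1ℝ

module _ (lower upper : ℝ → Point) {n : ℕ} (Z : ZigZag n) where
  open ZigZag Z

  zigZagTriangle : Vector Triangle n
  zigZagTriangle i = cut (s i)
    where
    cut : Sign → Triangle
    cut Sign.- = lower (p (inject₁ i)) ∷ lower (p (suc i)) ∷ upper (u (inject₁ i)) ∷ []
    cut Sign.+ = lower (p (inject₁ i)) ∷ upper (u (inject₁ i)) ∷ upper (u (suc i)) ∷ []

P Q S T : Point
P = 0ℝ , 0ℝ
Q = 1ℝ , 0ℝ
T = 1ℝ , 1ℝ
S = 0ℝ , 1ℝ

R : ℝ → Point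
R c = 1ℝ , 1ℝ - 2ℝ * c

capAndZigZag : ∀ {n} → ℝ → ZigZag n → Vector Triangle (suc n)
capAndZigZag c Z =
  (S ∷ T ∷ R c ∷ []) ∷ zigZagTriangle (along P Q) (along S (R c)) Z

infix 4 _≈△_ _≈ᶠ_

-- The same triangle, with its vertices possibly listed in another order.
_≈△_ : Triangle → Triangle → Set
A ≈△ B = Σ[ ρ ∈ Permutation′ 3 ] (∀ k → A k ≈ₚ B (ρ ⟨$⟩ʳ k))

-- The same collection of triangles, possibly listed in another order.
_≈ᶠ_ : ∀ {n} → Vector Triangle n → Vector Triangle n → Set
_≈ᶠ_ {n} As Bs = Σ[ π ∈ Permutation′ n ] (∀ i → As i ≈△ Bs (π ⟨$⟩ʳ i))

IsSingleCapTwoRail : ∀ {n} → Dissection (suc n) → Set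
IsSingleCapTwoRail {n} D =
  Σ[ σ ∈ Symmetry ] Σ[ c ∈ ℝ ] Σ[ Z ∈ ZigZag n ]
    ((0ℝ < c × c < ½ℝ)
    × triangle D ≈ᶠ map (map (act σ)) (capAndZigZag c Z))

module Submission where

-- If A is the area cut off by the segment joining the current points at
-- fractions w and z of the two rails, then (1 - 2cw)(1 - 2cz) = 1 - 4cA, and a
-- step changes only one of the two factors.  Hence the factor that stays during
-- a step is an alternating quotient of the numbers 1 - 4cA at the turns, and at
-- the end it must equal 1 - 2c.  When all nine areas are close to 1/9 this
-- equation is a perturbation of one between explicit fractions that fails, for
-- every direction sequence.  The failure is certified in integer arithmetic with
-- first-order enclosures in the deviations of the areas; the tightest sequence,
-- - + + - + - - +, would allow an area range of about 1/3074.
--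
-- All operations on reals act termwise on the Cauchy sequences, so the estimate is
-- carried out on the rational terms with a large index, where it is decidable.

open import Data.Bool using (Bool; true; false; _∧_; if_then_else_)
open import Data.Bool.Properties using (T-∧)
open import Data.Empty using (⊥)
open import Data.Fin using (Fin; zero; suc; inject₁; fromℕ)
open import Data.Fin.Patterns using (0F; 1F; 2F; 3F; 4F; 5F)
open import Data.Fin.Permutation using (Permutation′; _⟨$⟩ʳ_; _⟨$⟩ˡ_; inverseʳ; inverseˡ)
open import Data.Integer as ℤ using (ℤ; +_; -[1+_]; 0ℤ; 1ℤ)
import Data.Integer.Properties as ℤ
open import Data.Nat as ℕ using (ℕ; zero; suc; _<ᵇ_)
import Data.Nat.Properties as ℕ
open import Data.Product using (_×_; _,_; Σ-syntax; proj₁; proj₂)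
open import Data.Rational as ℚ using (ℚ; 0ℚ; 1ℚ; ½)
import Data.Rational.Properties as ℚ
open import Data.Rational.Solver using (module +-*-Solver)
open import Data.Sign as Sign using (Sign)
open import Data.Sum using (inj₁; inj₂)
open import Data.Vec.Functional using (Vector; head; tail; foldr)
open import Function using (_∘_; Equivalence)
open import Relation.Binary.PropositionalEquality
open import Relation.Nullary using (contradiction)
open import Relation.Nullary.Decidable using (toWitness)

module RationalWalks where

  open import Data.Bool using (T)
  open import Data.Rational
  open import Data.Rational.Literals using (fromℤ)
  open import Data.Rational.Properties
  import Data.Rational.Unnormalised.Base as ℚᵘ
  import Data.Rational.Unnormalised.Properties as ℚᵘ
  open import Data.Vec as Vec using (Vec; []; _∷_; zipWith)

  -- Integer bounds, and affine forms with an error radius.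

  fromℤ-homo-+ : ∀ i j → fromℤ (i ℤ.+ j) ≡ fromℤ i + fromℤ j
  fromℤ-homo-+ i j = toℚᵘ-injective (ℚᵘ.≃-trans
    (ℚᵘ.*≡* (cong (ℤ._* 1ℤ) (sym (cong₂ ℤ._+_ (ℤ.*-identityʳ i) (ℤ.*-identityʳ j)))))
    (ℚᵘ.≃-sym (toℚᵘ-homo-+ (fromℤ i) (fromℤ j))))

  fromℤ-homo-* : ∀ i j → fromℤ (i ℤ.* j) ≡ fromℤ i * fromℤ j
  fromℤ-homo-* i j = toℚᵘ-injective (ℚᵘ.≃-sym (toℚᵘ-homo-* (fromℤ i) (fromℤ j)))

  fromℤ-cancel-≤ : ∀ {i j} → fromℤ i ≤ fromℤ j → i ℤ.≤ j
  fromℤ-cancel-≤ {i} {j} (*≤* i≤j) =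
    subst₂ ℤ._≤_ (ℤ.*-identityʳ i) (ℤ.*-identityʳ j) i≤j

  infix 4 _≲_

  -- A record rather than a function, so that both arguments can be inferred from
  -- proofs; likewise _∈_ below.
  record _≲_ (q : ℚ) (k : ℕ) : Set where
    constructor bound
    field
      unbound : ∣ q ∣ ≤ fromℤ (+ k)

  open _≲_

  ≲-+ : ∀ {p q j k} → p ≲ j → q ≲ k → p + q ≲ j ℕ.+ k
  ≲-+ {p} {q} {j} {k} (bound p≤) (bound q≤) =
    bound (subst (∣ p + q ∣ ≤_) (sym (fromℤ-homo-+ (+ j) (+ k)))
      (≤-trans (∣p+q∣≤∣p∣+∣q∣ p q) (+-mono-≤ p≤ q≤)))

  ≲-* : ∀ {p q j k} → p ≲ j → q ≲ k → p * q ≲ j ℕ.* k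
  ≲-* {p} {q} {j} {k} (bound p≤) (bound q≤) = bound (begin
    ∣ p * q ∣                  ≡⟨ ∣p*q∣≡∣p∣*∣q∣ p q ⟩
    ∣ p ∣ * ∣ q ∣              ≤⟨ *-monoʳ-≤-nonNeg ∣ q ∣ {{∣-∣-nonNeg q}} p≤ ⟩
    fromℤ (+ j) * ∣ q ∣        ≤⟨ *-monoˡ-≤-nonNeg (fromℤ (+ j)) q≤ ⟩
    fromℤ (+ j) * fromℤ (+ k)  ≡⟨ fromℤ-homo-* (+ j) (+ k) ⟨
    fromℤ (+ j ℤ.* + k)        ≡⟨ cong fromℤ (sym (ℤ.pos-* j k)) ⟩
    fromℤ (+ (j ℕ.* k))        ∎)
    where open ≤-Reasoning

  ≲-fromℤ : ∀ i → fromℤ i ≲ ℤ.∣ i ∣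
  ≲-fromℤ i = bound ≤-refl

  ≲-neg : ∀ {q k} → q ≲ k → - q ≲ k
  ≲-neg {q} {k} (bound q≤) = bound (subst (_≤ fromℤ (+ k)) (sym (∣-p∣≡∣p∣ q)) q≤)

  -- Stands for all numbers within `radius` of an affine function of the deviations `y`. All forms
  -- refer to the same `y`, so first-order parts can cancel; plain intervals would forget this
  -- dependence.
  record Form (n : ℕ) : Set where
    constructor form
    field
      constant : ℤ
      linear   : Vec ℤ n
      radius   : ℕ

  open Form

  const : ∀ {n} → ℤ → Form n
  const k = form k (Vec.replicate _ 0ℤ) 0

  unit : ∀ {n} → Fin n → Vec ℤ n
  unit zero    = 1ℤ ∷ Vec.replicate _ 0ℤ
  unit (suc i) = 0ℤ ∷ unit i

  coord : ∀ {n} → Fin n → Form n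
  coord i = form 0ℤ (unit i) 0

  total : ∀ {n} → Form n
  total = form 0ℤ (Vec.replicate _ 1ℤ) 0

  widen : ∀ {n} → ℕ → Form n → Form n
  widen k (form a l r) = form a l (k ℕ.+ r)

  infixl 6 _⊕_
  infixr 7 _⊙_
  infixl 7 _⊗_[_]

  _⊕_ : ∀ {n} → Form n → Form n → Form n
  form a l r ⊕ form a′ l′ r′ = form (a ℤ.+ a′) (zipWith ℤ._+_ l l′) (r ℕ.+ r′)

  _⊙_ : ∀ {n} → ℤ → Form n → Form n
  k ⊙ form a l r = form (k ℤ.* a) (Vec.map (k ℤ.*_) l) (ℤ.∣ k ∣ ℕ.* r)

  norm : ∀ {n} → ℕ → Vec ℤ n → ℕ
  norm B []      = 0
  norm B (x ∷ l) = ℤ.∣ x ∣ ℕ.* B ℕ.+ norm B l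

  -- `B` bounds every deviation, so `norm B l` bounds the linear part. The product of the two linear
  -- parts is of second order and goes into the radius, together with each error times the other
  -- factor and the product of the errors.
  _⊗_[_] : ∀ {n} → Form n → Form n → ℕ → Form n
  form a l r ⊗ form a′ l′ r′ [ B ] = form (a ℤ.* a′)
    (zipWith ℤ._+_ (Vec.map (a ℤ.*_) l′) (Vec.map (a′ ℤ.*_) l))
    (norm B l ℕ.* norm B l′ ℕ.+ (ℤ.∣ a ∣ ℕ.+ norm B l) ℕ.* r′ ℕ.+
      r ℕ.* (ℤ.∣ a′ ∣ ℕ.+ norm B l′) ℕ.+ r ℕ.* r′)

  nonzero? : ∀ {n} → ℕ → Form n → Bool
  nonzero? B (form a l r) = norm B l ℕ.+ r <ᵇ ℤ.∣ a ∣

  dot : ∀ {n} → Vec ℤ n → Vector ℚ n → ℚ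
  dot []      y = 0ℚ
  dot (x ∷ l) y = fromℤ x * head y + dot l (tail y)

  sum : ∀ {n} → Vector ℚ n → ℚ
  sum = foldr _+_ 0ℚ

  dot-zero : ∀ {n} (y : Vector ℚ n) → dot (Vec.replicate n 0ℤ) y ≡ 0ℚ
  dot-zero {zero}  y = refl
  dot-zero {suc n} y = trans (cong₂ _+_ (*-zeroˡ (head y)) (dot-zero (tail y))) refl

  dot-one : ∀ {n} (y : Vector ℚ n) → dot (Vec.replicate n 1ℤ) y ≡ sum y
  dot-one {zero}  y = refl
  dot-one {suc n} y = cong₂ _+_ (*-identityˡ (head y)) (dot-one (tail y))

  dot-unit : ∀ {n} (i : Fin n) (y : Vector ℚ n) → dot (unit i) y ≡ y i
  dot-unit zero y = trans
    (cong₂ _+_ (*-identityˡ (head y)) (dot-zero (tail y))) (+-identityʳ (head y))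
  dot-unit (suc i) y = trans
    (cong₂ _+_ (*-zeroˡ (head y)) (dot-unit i (tail y))) (+-identityˡ (y (suc i)))

  dot-+ : ∀ {n} (l l′ : Vec ℤ n) y → dot (zipWith ℤ._+_ l l′) y ≡ dot l y + dot l′ y
  dot-+ []      []        y = refl
  dot-+ (x ∷ l) (x′ ∷ l′) y rewrite fromℤ-homo-+ x x′ | dot-+ l l′ (tail y) =
    solve 5 (λ a b h d e → (a :+ b) :* h :+ (d :+ e) := (a :* h :+ d) :+ (b :* h :+ e))
      refl (fromℤ x) (fromℤ x′) (head y) (dot l (tail y)) (dot l′ (tail y))
    where open +-*-Solver

  dot-map : ∀ {n} k (l : Vec ℤ n) y → dot (Vec.map (k ℤ.*_) l) y ≡ fromℤ k * dot l y
  dot-map k []      y = sym (*-zeroʳ (fromℤ k))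
  dot-map k (x ∷ l) y rewrite fromℤ-homo-* k x | dot-map k l (tail y) =
    solve 4 (λ k a h d → k :* a :* h :+ k :* d := k :* (a :* h :+ d))
      refl (fromℤ k) (fromℤ x) (head y) (dot l (tail y))
    where open +-*-Solver

  dot-bound : ∀ {n} {B} (l : Vec ℤ n) {y} → (∀ i → y i ≲ B) → dot l y ≲ norm B l
  dot-bound []      y≲ = bound ≤-refl
  dot-bound (x ∷ l) y≲ = ≲-+ (≲-* (≲-fromℤ x) (y≲ zero)) (dot-bound l (y≲ ∘ suc))

  -- Soundness of the arithmetic of forms.

  module Enclosure {n} (B : ℕ) (y : Vector ℚ n) (y≲ : ∀ i → y i ≲ B) where

    value : Form n → ℚ
    value f = fromℤ (constant f) + dot (linear f) y

    infix 4 _∈_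

    record _∈_ (q : ℚ) (f : Form n) : Set where
      constructor within
      field
        error : q - value f ≲ radius f

    exact : ∀ {q} a l → q ≡ value (form a l 0) → q ∈ form a l 0
    exact a l refl = within (bound (≤-reflexive (cong ∣_∣ (+-inverseʳ (value (form a l 0))))))

    ∈-const : ∀ k → fromℤ k ∈ const k
    ∈-const k = exact k _
      (sym (trans (cong₂ _+_ (refl {x = fromℤ k}) (dot-zero y)) (+-identityʳ (fromℤ k))))

    ∈-coord : ∀ i → y i ∈ coord i
    ∈-coord i = exact 0ℤ _
      (sym (trans (cong₂ _+_ (refl {x = 0ℚ}) (dot-unit i y)) (+-identityˡ (y i))))

    ∈-total : sum y ∈ total
    ∈-total = exact 0ℤ _
      (sym (trans (cong₂ _+_ (refl {x = 0ℚ}) (dot-one y)) (+-identityˡ (sum y))))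

    ∈-widen : ∀ {e q k} f → e ≲ k → q ∈ f → e + q ∈ widen k f
    ∈-widen {e} {q} {k} f e≲ (within q≲) =
      within (subst (_≲ k ℕ.+ radius f) (sym (+-assoc e q (- value f))) (≲-+ e≲ q≲))

    ∈-⊕ : ∀ {p q} f g → p ∈ f → q ∈ g → p + q ∈ f ⊕ g
    ∈-⊕ {p} {q} f@(form a l r) g@(form a′ l′ r′) (within p≲) (within q≲) =
      within (subst (_≲ r ℕ.+ r′) lemma (≲-+ p≲ q≲))
      where
      open +-*-Solver
      lemma : (p - value f) + (q - value g) ≡ p + q - value (f ⊕ g)
      lemma rewrite fromℤ-homo-+ a a′ | dot-+ l l′ y =
        solve 6 (λ p q a a′ d d′ → (p :- (a :+ d)) :+ (q :- (a′ :+ d′)) :=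
            p :+ q :- ((a :+ a′) :+ (d :+ d′)))
          refl p q (fromℤ a) (fromℤ a′) (dot l y) (dot l′ y)

    ∈-⊙ : ∀ {q} k f → q ∈ f → fromℤ k * q ∈ k ⊙ f
    ∈-⊙ {q} k f@(form a l r) (within q≲) =
      within (subst (_≲ ℤ.∣ k ∣ ℕ.* r) lemma (≲-* (≲-fromℤ k) q≲))
      where
      open +-*-Solver
      lemma : fromℤ k * (q - value f) ≡ fromℤ k * q - value (k ⊙ f)
      lemma rewrite fromℤ-homo-* k a | dot-map k l y =
        solve 4 (λ k q a d → k :* (q :- (a :+ d)) := k :* q :- (k :* a :+ k :* d))
          refl (fromℤ k) q (fromℤ a) (dot l y)

    ∈-⊗ : ∀ {p q} f g → p ∈ f → q ∈ g → p * q ∈ f ⊗ g [ B ]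
    ∈-⊗ {p} {q} f@(form a l r) g@(form a′ l′ r′) (within p≲) (within q≲) =
      within (subst (_≲ radius (f ⊗ g [ B ])) lemma
        (≲-+ (≲-+ (≲-+ (≲-* d≲ d′≲) (≲-* (≲-+ (≲-fromℤ a) d≲) q≲))
          (≲-* p≲ (≲-+ (≲-fromℤ a′) d′≲))) (≲-* p≲ q≲)))
      where
      open +-*-Solver
      d = dot l y
      d′ = dot l′ y
      d≲ = dot-bound l y≲
      d′≲ = dot-bound l′ y≲
      lemma : d * d′ + value f * (q - value g) + (p - value f) * value g
                + (p - value f) * (q - value g) ≡ p * q - value (f ⊗ g [ B ])
      lemma rewrite fromℤ-homo-* a a′
                  | dot-+ (Vec.map (a ℤ.*_) l′) (Vec.map (a′ ℤ.*_) l) y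
                  | dot-map a l′ y | dot-map a′ l y =
        solve 6 (λ p q a a′ d d′ →
            d :* d′ :+ (a :+ d) :* (q :- (a′ :+ d′)) :+ (p :- (a :+ d)) :* (a′ :+ d′)
              :+ (p :- (a :+ d)) :* (q :- (a′ :+ d′)) :=
            p :* q :- (a :* a′ :+ (a :* d′ :+ a′ :* d)))
          refl p q (fromℤ a) (fromℤ a′) d d′

    -- If 0 were enclosed, the constant would be minus the linear part up to an error of at most
    -- `r`, so its absolute value could not exceed `norm B l + r`.
    0∉ : ∀ f → T (nonzero? B f) → 0ℚ ∈ f → ⊥
    0∉ f@(form a l r) nz (within 0≲) = ℕ.<⇒≱ (ℕ.<ᵇ⇒< _ _ nz)
      (ℤ.drop‿+≤+ (fromℤ-cancel-≤ (unbound (subst (_≲ norm B l ℕ.+ r) lemma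
        (≲-neg (≲-+ (dot-bound l y≲) 0≲))))))
      where
      open +-*-Solver
      lemma : - (dot l y + (0ℚ - value f)) ≡ fromℤ a
      lemma = solve 2 (λ a d → :- (d :+ (con 0ℚ :- (a :+ d))) := a)
        refl (fromℤ a) (dot l y)

  -- Walks along the two rails and the test that excludes them.

  stepArea : (c w w′ z : ℚ) → ℚ
  stepArea c w w′ z = ½ * ((w′ - w) * (1ℚ - (1ℚ + 1ℚ) * c * z))

  -- The area cut off by the segment between the fractions `w` and `z`: `1 - 4c · swept c w z`
  -- factors as `(1 - 2cw)(1 - 2cz)`.
  swept : (c w z : ℚ) → ℚ
  swept c w z = ½ * (w + z) - c * w * z

  -- w and z are the fractions traversed of the two rails, in either order.
  data Walk (c η : ℚ) : ∀ {n} → Vector ℚ n → ℚ → ℚ → Set where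
    done : ∀ {b : Vector ℚ 0} {w z} → ∣ swept c w z - (1ℚ - c) ∣ ≤ η →
      ∣ (1ℚ + 1ℚ) * c * w - (1ℚ + 1ℚ) * c ∣ ≤ η →
      ∣ (1ℚ + 1ℚ) * c * z - (1ℚ + 1ℚ) * c ∣ ≤ η → Walk c η b w z
    stepˡ : ∀ {n} {b : Vector ℚ (suc n)} {w z} w′ →
      ∣ stepArea c w w′ z - head b ∣ ≤ η → Walk c η (tail b) w′ z → Walk c η b w z
    stepʳ : ∀ {n} {b : Vector ℚ (suc n)} {w z} z′ →
      ∣ stepArea c z z′ w - head b ∣ ≤ η → Walk c η (tail b) w z′ → Walk c η b w z

  swept-comm : ∀ c w z → swept c w z ≡ swept c z w
  swept-comm = solve 3 (λ c w z → con ½ :* (w :+ z) :- c :* w :* z :=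
                                  con ½ :* (z :+ w) :- c :* z :* w) refl
    where open +-*-Solver

  -- The formulas treat both rails alike, so a walk may be relabelled. This lets the inductions keep
  -- in second place the point that stayed during the last step.
  Walk-swap : ∀ {c η n} {b : Vector ℚ n} {w z} → Walk c η b w z → Walk c η b z w
  Walk-swap {c} {η} {w = w} {z} (done e w≈ z≈) =
    done (subst (λ q → ∣ q - (1ℚ - c) ∣ ≤ η) (swept-comm c w z) e) z≈ w≈
  Walk-swap (stepˡ w′ e v) = stepʳ w′ e (Walk-swap v)
  Walk-swap (stepʳ z′ e v) = stepˡ z′ e (Walk-swap v)

  -- `swept` is affine in `w` with slope `½ (1 - 2cz)`, so the area of a step is an exact increment,
  -- whatever the order of `w` and `w′`.
  swept-step : ∀ c w w′ z → swept c w z + stepArea c w w′ z ≡ swept c w′ z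
  swept-step c w w′ z = solve 4 (λ c w w′ z →
      (con ½ :* (w :+ z) :- c :* w :* z)
        :+ con ½ :* ((w′ :- w) :* (con 1ℚ :- (con 1ℚ :+ con 1ℚ) :* c :* z)) :=
      con ½ :* (w′ :+ z) :- c :* w′ :* z) refl c w w′ z
    where open +-*-Solver

  -- Encloses κ² (1 - 2cw) (1 - 2cz) if C encloses κ c and A encloses κ · swept c w z.
  product : ∀ {n} → ℕ → ℤ → Form n → Form n → Form n
  product B κ C A = const (κ ℤ.* κ) ⊕ (-[1+ 3 ] ⊙ (C ⊗ A [ B ]))

  -- Encloses `κ (1 - 2cz)` at the end of a walk, where `2cz` may still differ from `2c` by `η`;
  -- scaled by `κ` this costs a radius of 1.
  lastFactor : ∀ {n} → ℤ → Form n → Form n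
  lastFactor κ C = widen 1 (const κ ⊕ (-[1+ 1 ] ⊙ C))

  -- The factor that stays is N / D.  At a turn it is replaced by the other one,
  -- product / (N / D), and D absorbs the scale κ².
  check : ∀ {n} → ℕ → ℤ → Form n → ∀ {k} → Vector (Form n) k →
    Form n → Form n → Form n → Bool
  check B κ C {zero} fs A N D =
    nonzero? B ((lastFactor κ C ⊗ D [ B ]) ⊕ (-[1+ 0 ] ⊙ (κ ⊙ N)))
  check B κ C {suc k} fs A N D =
    check B κ C (tail fs) (A ⊕ head fs) N D ∧
    check B κ C (tail fs) (A ⊕ head fs) (product B κ C A ⊗ D [ B ]) ((κ ℤ.* κ) ⊙ N)

  -- Soundness of the test on walks.

  module _ {n} (B : ℕ) (y : Vector ℚ n) (y≲ : ∀ i → y i ≲ B) (κ : ℤ) {c η : ℚ}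
           (small : ∀ {e} → ∣ e ∣ ≤ η → fromℤ κ * e ≲ 1) where

    open Enclosure B y y≲

    -- Induction on the walk. The invariant says that `1 - 2cz` is the quotient of `q` by `r`,
    -- written as a product so that no denominator has to be nonzero. At the end the tested form
    -- encloses `κ (1 - 2cz) r - κ q`, which is 0.
    no-walk : ∀ {C} → fromℤ κ * c ∈ C →
      ∀ {k} {fs : Vector (Form n) k} {b : Vector ℚ k} {A N D w z q r} →
      (∀ i a → ∣ a - b i ∣ ≤ η → fromℤ κ * a ∈ fs i) →
      fromℤ κ * swept c w z ∈ A → q ∈ N → r ∈ D →
      (1ℚ - (1ℚ + 1ℚ) * c * z) * r ≡ q → Walk c η b w z → T (check B κ C fs A N D) → ⊥
    no-walk {C} c∈ {zero} {N = N} {D} {z = z} {q} {r} b∈ A∈ N∈ D∈ refl (done _ _ z≈) ok =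
      0∉ _ ok (subst (_∈ (lastFactor κ C ⊗ D [ B ]) ⊕ (-[1+ 0 ] ⊙ (κ ⊙ N))) vanish
        (∈-⊕ (lastFactor κ C ⊗ D [ B ]) (-[1+ 0 ] ⊙ (κ ⊙ N))
          (∈-⊗ (lastFactor κ C) D (∈-widen (const κ ⊕ (-[1+ 1 ] ⊙ C))
              (≲-neg (small z≈))
              (∈-⊕ (const κ) (-[1+ 1 ] ⊙ C) (∈-const κ) (∈-⊙ -[1+ 1 ] C c∈)))
            D∈)
          (∈-⊙ -[1+ 0 ] (κ ⊙ N) (∈-⊙ κ N N∈))))
      where
      open +-*-Solver
      vanish : _ ≡ 0ℚ
      vanish = solve 4 (λ κ c z r →
          (:- (κ :* ((con 1ℚ :+ con 1ℚ) :* c :* z :- (con 1ℚ :+ con 1ℚ) :* c))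
            :+ (κ :+ con (fromℤ -[1+ 1 ]) :* (κ :* c))) :* r
            :+ con (fromℤ -[1+ 0 ]) :* (κ :* ((con 1ℚ :- (con 1ℚ :+ con 1ℚ) :* c :* z) :* r))
          := con 0ℚ) refl (fromℤ κ) c z r
    no-walk c∈ {suc k} {fs} {A = A} {N} {D} {w} {z} b∈ A∈ N∈ D∈ eq (stepˡ w′ e v) ok =
      let ok₁ , _ = Equivalence.to T-∧ ok
      in no-walk c∈ (b∈ ∘ suc)
           (subst (_∈ A ⊕ head fs) advance (∈-⊕ A (head fs) A∈ (b∈ zero (stepArea c w w′ z) e)))
           N∈ D∈ eq v ok₁
      where
      advance : fromℤ κ * swept c w z + fromℤ κ * stepArea c w w′ z ≡ fromℤ κ * swept c w′ z
      advance = trans (sym (*-distribˡ-+ (fromℤ κ) (swept c w z) (stepArea c w w′ z)))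
        (cong (fromℤ κ *_) (swept-step c w w′ z))
    no-walk {C} c∈ {suc k} {fs} {A = A} {N} {D} {w} {z} {q} {r}
            b∈ A∈ N∈ D∈ refl (stepʳ z′ e v) ok =
      let _ , ok₂ = Equivalence.to T-∧ ok
      in no-walk c∈ (b∈ ∘ suc)
           (subst (_∈ A ⊕ head fs) advance (∈-⊕ A (head fs) A∈ (b∈ zero (stepArea c z z′ w) e)))
           (∈-⊗ (product B κ C A) D (∈-⊕ (const (κ ℤ.* κ)) (-[1+ 3 ] ⊙ (C ⊗ A [ B ]))
             (∈-const (κ ℤ.* κ)) (∈-⊙ -[1+ 3 ] (C ⊗ A [ B ]) (∈-⊗ C A c∈ A∈))) D∈)
           (∈-⊙ (κ ℤ.* κ) N N∈) turn (Walk-swap v) ok₂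
      where
      open +-*-Solver
      advance : fromℤ κ * swept c w z + fromℤ κ * stepArea c z z′ w ≡ fromℤ κ * swept c z′ w
      advance = trans (sym (*-distribˡ-+ (fromℤ κ) (swept c w z) (stepArea c z z′ w)))
        (cong (fromℤ κ *_)
          (trans (cong (_+ stepArea c z z′ w) (swept-comm c w z)) (swept-step c z z′ w)))
      -- This is `(1 - 2cw)(1 - 2cz) = 1 - 4c · swept c w z`, with the area before the step,
      -- multiplied by `κ² r`.
      turn : (1ℚ - (1ℚ + 1ℚ) * c * w) * (fromℤ (κ ℤ.* κ) * ((1ℚ - (1ℚ + 1ℚ) * c * z) * r))
        ≡ (fromℤ (κ ℤ.* κ) + fromℤ -[1+ 3 ] * ((fromℤ κ * c) * (fromℤ κ * swept c w z))) * r
      turn rewrite fromℤ-homo-* κ κ =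
        solve 5 (λ κ c w z r →
          (con 1ℚ :- (con 1ℚ :+ con 1ℚ) :* c :* w) :*
            ((κ :* κ) :* ((con 1ℚ :- (con 1ℚ :+ con 1ℚ) :* c :* z) :* r)) :=
          ((κ :* κ) :+ con (fromℤ -[1+ 3 ]) :*
            ((κ :* c) :* (κ :* (con ½ :* (w :+ z) :- c :* w :* z)))) :* r)
          refl (fromℤ κ) c w z r

  -- An area range of at most 2ρ puts every area within ρ of some γ, and η bounds
  -- the errors made by replacing reals with terms of their sequences.  The scale is
  -- chosen such that κ = 9μ, κη = 1 and μρ = 3000.
  μ κ : ℤ
  μ = + 19800000
  κ = + 178200000

  ρ η : ℚ
  ρ = + 1 / 6600
  η = + 1 / 178200000

  -- Since the areas add up to 1, κ bⱼ = μ + 9yⱼ - Σ y for yⱼ = μ(bⱼ - γ); the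
  -- approximation errors total at most 11.
  base : Fin 9 → Form 9
  base j = widen 11 (const μ ⊕ (+ 9 ⊙ coord j) ⊕ (-[1+ 0 ] ⊙ total))

  -- The test evaluates to `true` during type checking, over all 256 direction sequences. Nothing is
  -- swept at the start and both factors are 1, hence the forms `const 0ℤ` and `const 1ℤ`; the bound
  -- 3000 is `μρ`.
  checked : T (check 3000 κ (base zero) (tail base) (const 0ℤ) (const 1ℤ) (const 1ℤ))
  checked = _

  -- Scaled approximation errors and the total area.

  scaled : ∀ k m {q r} → fromℤ (+ k) * r ≤ fromℤ (+ m) → ∣ q ∣ ≤ r → fromℤ (+ k) * q ≲ m
  scaled k m {q} {r} kr≤m q≤ = bound (begin
    ∣ fromℤ (+ k) * q ∣      ≡⟨ ∣p*q∣≡∣p∣*∣q∣ (fromℤ (+ k)) q ⟩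
    fromℤ (+ k) * ∣ q ∣      ≤⟨ *-monoˡ-≤-nonNeg (fromℤ (+ k)) q≤ ⟩
    fromℤ (+ k) * r          ≤⟨ kr≤m ⟩
    fromℤ (+ m)              ∎)
    where open ≤-Reasoning

  small-κ : ∀ {q} → ∣ q ∣ ≤ η → fromℤ κ * q ≲ 1
  small-κ = scaled 178200000 1 (toWitness {a? = fromℤ κ * η ≤? fromℤ 1ℤ} _)

  small-μ : ∀ {q} → ∣ q ∣ ≤ η → fromℤ μ * q ≲ 1
  small-μ = scaled 19800000 1 (toWitness {a? = fromℤ μ * η ≤? fromℤ 1ℤ} _)

  small-ρ : ∀ {q} → ∣ q ∣ ≤ ρ → fromℤ μ * q ≲ 3000
  small-ρ = scaled 19800000 3000 (toWitness {a? = fromℤ μ * ρ ≤? fromℤ (+ 3000)} _)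

  sum-deviations : ∀ {n} m γ (b : Vector ℚ n) →
    sum (λ i → m * (b i - γ)) ≡ m * (sum b - sum {n} (λ _ → γ))
  sum-deviations {zero}  m γ b = sym (*-zeroʳ m)
  sum-deviations {suc n} m γ b rewrite sum-deviations m γ (tail b) =
    solve 5 (λ m γ h s g → m :* (h :- γ) :+ m :* (s :- g) := m :* (h :+ s :- (γ :+ g)))
      refl m γ (head b) (sum (tail b)) (sum {n} (λ _ → γ))
    where open +-*-Solver

  total-step : ∀ {n k} c w w′ z (b : Vector ℚ (suc n)) → ∣ stepArea c w w′ z - head b ∣ ≤ η →
    fromℤ μ * (sum (tail b) + swept c w′ z - (1ℚ - c)) ≲ k →
    fromℤ μ * (sum b + swept c w z - (1ℚ - c)) ≲ suc k
  total-step {k = k} c w w′ z b e rest =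
    subst (_≲ suc k) (trans (cong (λ q → - (fromℤ μ * (stepArea c w w′ z - head b))
          + fromℤ μ * (sum (tail b) + q - (1ℚ - c))) (sym (swept-step c w w′ z)))
        (solve 6 (λ m a h s p c →
          :- (m :* (a :- h)) :+ m :* (s :+ (p :+ a) :- (con 1ℚ :- c)) :=
          m :* (h :+ s :+ p :- (con 1ℚ :- c)))
        refl (fromℤ μ) (stepArea c w w′ z) (head b) (sum (tail b)) (swept c w z) c))
      (≲-+ (≲-neg (small-μ e)) rest)
    where open +-*-Solver

  -- By `swept-step` the area already swept and the areas still to come add up to the trapezoid,
  -- `1 - c`. After scaling by `μ`, each of the `n` steps and the end condition contribute an error
  -- of at most 1.
  walk-total : ∀ {n c} {b : Vector ℚ n} {w z} → Walk c η b w z →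
    fromℤ μ * (sum b + swept c w z - (1ℚ - c)) ≲ suc n
  walk-total {zero} {c} {w = w} {z} (done e _ _) =
    subst (λ q → fromℤ μ * (q - (1ℚ - c)) ≲ 1) (sym (+-identityˡ (swept c w z))) (small-μ e)
  walk-total {suc n} {c} {b} {w} {z} (stepˡ w′ e v) =
    total-step c w w′ z b e (walk-total v)
  walk-total {suc n} {c} {b} {w} {z} (stepʳ z′ e v) =
    subst (λ q → fromℤ μ * (sum b + q - (1ℚ - c)) ≲ suc (suc n)) (swept-comm c z w)
      (total-step c z z′ w b e (walk-total (Walk-swap v)))

  -- The centre `γ` may be unknown because it cancels from `9yⱼ - Σ y`; the total area 1 fixes the
  -- scale instead.
  wide-range : ∀ {c γ} (b : Vector ℚ 9) → ∣ c - head b ∣ ≤ η → (∀ i → ∣ b i - γ ∣ ≤ ρ) →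
    Walk c η (tail b) 0ℚ 0ℚ → ⊥
  wide-range {c} {γ} b c≈ b≈ v =
    no-walk 3000 y (small-ρ ∘ b≈) κ small-κ (b∈ zero c c≈) (b∈ ∘ suc)
      (subst (_∈ const 0ℤ) zero-area (∈-const 0ℤ)) (∈-const 1ℤ) (∈-const 1ℤ) one v checked
    where
    open +-*-Solver
    y : Vector ℚ 9
    y i = fromℤ μ * (b i - γ)
    open Enclosure 3000 y (small-ρ ∘ b≈)
    zero-area : 0ℚ ≡ fromℤ κ * swept c 0ℚ 0ℚ
    zero-area = solve 2 (λ κ c →
        con 0ℚ := κ :* (con ½ :* (con 0ℚ :+ con 0ℚ) :- c :* con 0ℚ :* con 0ℚ))
      refl (fromℤ κ) c
    one : (1ℚ - (1ℚ + 1ℚ) * c * 0ℚ) * fromℤ 1ℤ ≡ fromℤ 1ℤ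
    one = solve 1 (λ c →
      (con 1ℚ :- (con 1ℚ :+ con 1ℚ) :* c :* con 0ℚ) :* con 1ℚ := con 1ℚ) refl c
    -- Nine units of error come from the eight steps and the end, one from the cap.
    total≈ : fromℤ μ * (sum b - 1ℚ) ≲ 10
    total≈ = subst (_≲ 10)
      (solve 4 (λ m c h s → m :* (s :+ (con ½ :* (con 0ℚ :+ con 0ℚ) :- c :* con 0ℚ :* con 0ℚ)
            :- (con 1ℚ :- c)) :+ :- (m :* (c :- h)) :=
          m :* (h :+ s :- con 1ℚ))
        refl (fromℤ μ) c (head b) (sum (tail b)))
      (≲-+ (walk-total v) (≲-neg (small-μ c≈)))
    -- `κ a` is the affine form plus the error of the total area, at most 10, and that of `a`
    -- against `b j`, at most 1; together these give the widening by 11 in `base`.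
    b∈ : ∀ j a → ∣ a - b j ∣ ≤ η → fromℤ κ * a ∈ base j
    b∈ j a a≈ = subst (_∈ base j) (trans (cong (λ s → fromℤ μ * (sum b - 1ℚ) + fromℤ κ * (a - b j)
          + (fromℤ μ + fromℤ (+ 9) * y j + fromℤ -[1+ 0 ] * s)) (sum-deviations (fromℤ μ) γ b))
        (trans (cong (λ k → fromℤ μ * (sum b - 1ℚ) + k * (a - b j)
          + (fromℤ μ + fromℤ (+ 9) * y j + fromℤ -[1+ 0 ] *
              (fromℤ μ * (sum b - sum {9} (λ _ → γ))))) κ≡9μ)
          (trans (solve 5 (λ m s a h γ →
              m :* (s :- con 1ℚ) :+ (con (fromℤ (+ 9)) :* m) :* (a :- h) :+
                (m :+ con (fromℤ (+ 9)) :* (m :* (h :- γ)) :+ con (fromℤ -[1+ 0 ]) :*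
                  (m :* (s :- (γ :+ (γ :+ (γ :+ (γ :+ (γ :+ (γ :+ (γ :+ (γ :+ (γ :+ con 0ℚ)))))))))))) :=
              (con (fromℤ (+ 9)) :* m) :* a)
            refl (fromℤ μ) (sum b) a (b j) γ) (cong (_* a) (sym κ≡9μ)))))
      (∈-widen _ (≲-+ total≈ (small-κ a≈))
        (∈-⊕ (const μ ⊕ (+ 9 ⊙ coord j)) (-[1+ 0 ] ⊙ total)
          (∈-⊕ (const μ) (+ 9 ⊙ coord j) (∈-const μ) (∈-⊙ (+ 9) (coord j) (∈-coord j)))
          (∈-⊙ -[1+ 0 ] total ∈-total)))
      where
      κ≡9μ : fromℤ κ ≡ fromℤ (+ 9) * fromℤ μ
      κ≡9μ = fromℤ-homo-* (+ 9) μ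

open import Defs
open import Data.Integer using (+_)
open import Data.Rational using (_/_)
open import Data.Vec.Functional using (_∷_; []; map)

open RationalWalks using (stepArea; swept; Walk; done; stepˡ; stepʳ; ρ; η; wide-range)

-- Rational estimates, and congruence of the operations on reals.

∣∣≤ : ∀ {q r} → q ℚ.≤ r → ℚ.- q ℚ.≤ r → ℚ.∣ q ∣ ℚ.≤ r
∣∣≤ {q} q≤ -q≤ with ℚ.∣p∣≡p∨∣p∣≡-p q
... | inj₁ e = ℚ.≤-trans (ℚ.≤-reflexive e) q≤
... | inj₂ e = ℚ.≤-trans (ℚ.≤-reflexive e) -q≤

∣∣-sym : ∀ p q → ℚ.∣ p ℚ.- q ∣ ≡ ℚ.∣ q ℚ.- p ∣
∣∣-sym p q = trans (sym (ℚ.∣-p∣≡∣p∣ (p ℚ.- q)))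
  (cong ℚ.∣_∣ (solve 2 (λ p q → :- (p :- q) := q :- p) refl p q))
  where open +-*-Solver

∣∣-split : ∀ p {q r} → p ≡ q ℚ.+ r → ℚ.∣ p ∣ ℚ.≤ ℚ.∣ q ∣ ℚ.+ ℚ.∣ r ∣
∣∣-split p {q} {r} refl = ℚ.∣p+q∣≤∣p∣+∣q∣ q r

*-nonNeg : ∀ {p q} → 0ℚ ℚ.≤ p → 0ℚ ℚ.≤ q → 0ℚ ℚ.≤ p ℚ.* q
*-nonNeg {p} {q} 0≤p 0≤q = ℚ.nonNegative⁻¹ (p ℚ.* q)
  {{ℚ.nonNeg*nonNeg⇒nonNeg p {{ℚ.nonNegative 0≤p}} q {{ℚ.nonNegative 0≤q}}}}

infixr 5 _∩_

_∩_ : ∀ {P Q} → Eventually P → Eventually Q → Eventually (λ n → P n × Q n)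
(M , p) ∩ (N , q) = M ℕ.⊔ N , λ n ≤n →
  p n (ℕ.m⊔n≤o⇒m≤o M N ≤n) , q n (ℕ.m⊔n≤o⇒n≤o M N ≤n)

eventually-map : ∀ {P Q} → (∀ {n} → P n → Q n) → Eventually P → Eventually Q
eventually-map f (N , p) = N , λ n N≤n → f (p n N≤n)

-- The given estimate is used at `ε / K`, so proofs of congruence may lose a constant factor.
≈-scaled : ∀ {x y} K → .{{_ : ℚ.Positive K}} →
  (∀ ε → 0ℚ ℚ.< ε → Eventually (λ n → ℚ.∣ seq x n ℚ.- seq y n ∣ ℚ.≤ K ℚ.* ε)) → x ≈ y
≈-scaled {x} {y} K close ε ε>0 =
  eventually-map (λ {n} → subst (ℚ.∣ seq x n ℚ.- seq y n ∣ ℚ.≤_) Kδ≡ε) (close δ δ>0)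
  where
  instance
    K≢0 : ℚ.NonZero K
    K≢0 = ℚ.pos⇒nonZero K
  δ : ℚ
  δ = ℚ.1/ K ℚ.* ε
  δ>0 : 0ℚ ℚ.< δ
  δ>0 = subst (ℚ._< δ) (ℚ.*-zeroʳ (ℚ.1/ K)) (ℚ.*-monoʳ-<-pos (ℚ.1/ K) {{ℚ.1/pos⇒pos K}} ε>0)
  Kδ≡ε : K ℚ.* δ ≡ ε
  Kδ≡ε = trans (sym (ℚ.*-assoc K (ℚ.1/ K) ε))
    (trans (cong (ℚ._* ε) (ℚ.*-inverseʳ K)) (ℚ.*-identityˡ ε))

≈-eventually : ∀ {x y} → Eventually (λ n → seq x n ≡ seq y n) → x ≈ y
≈-eventually {x} {y} x≡y ε ε>0 = eventually-map
  (λ {n} e → ℚ.≤-trans (ℚ.≤-reflexive (cong ℚ.∣_∣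
    (trans (cong (ℚ._- seq y n) e) (ℚ.+-inverseʳ (seq y n))))) (ℚ.<⇒≤ ε>0)) x≡y

≈-pointwise : ∀ {x y} → (∀ n → seq x n ≡ seq y n) → x ≈ y
≈-pointwise {x} {y} x≡y = ≈-eventually {x} {y} (0 , λ n _ → x≡y n)

≈-refl : ∀ {x} → x ≈ x
≈-refl {x} = ≈-pointwise {x} {x} (λ _ → refl)

≈-sym : ∀ {x y} → x ≈ y → y ≈ x
≈-sym {x} {y} x≈y ε ε>0 = eventually-map
  (λ {n} → subst (ℚ._≤ ε) (∣∣-sym (seq x n) (seq y n))) (x≈y ε ε>0)

double : ∀ {p q ε} → p ℚ.≤ ε → q ℚ.≤ ε → p ℚ.+ q ℚ.≤ (1ℚ ℚ.+ 1ℚ) ℚ.* ε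
double {ε = ε} p≤ q≤ = ℚ.≤-trans (ℚ.+-mono-≤ p≤ q≤)
  (ℚ.≤-reflexive (solve 1 (λ e → e :+ e := (con 1ℚ :+ con 1ℚ) :* e) refl ε))
  where open +-*-Solver

≈-trans : ∀ {x y z} → x ≈ y → y ≈ z → x ≈ z
≈-trans {x} {y} {z} x≈y y≈z = ≈-scaled {x} {z} (1ℚ ℚ.+ 1ℚ) λ ε ε>0 →
  eventually-map (λ {n} (p , q) → ℚ.≤-trans
    (∣∣-split (seq x n ℚ.- seq z n) {seq x n ℚ.- seq y n} {seq y n ℚ.- seq z n}
      (solve 3 (λ x y z → x :- z := (x :- y) :+ (y :- z)) refl (seq x n) (seq y n) (seq z n)))
    (double p q)) (x≈y ε ε>0 ∩ y≈z ε ε>0)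
  where open +-*-Solver

+-cong : ∀ {x x′ y y′} → x ≈ x′ → y ≈ y′ → x + y ≈ x′ + y′
+-cong {x} {x′} {y} {y′} x≈ y≈ = ≈-scaled {x + y} {x′ + y′} (1ℚ ℚ.+ 1ℚ) λ ε ε>0 →
  eventually-map (λ {n} (p , q) → ℚ.≤-trans
    (∣∣-split (seq (x + y) n ℚ.- seq (x′ + y′) n) {seq x n ℚ.- seq x′ n} {seq y n ℚ.- seq y′ n}
      (solve 4 (λ x y x′ y′ → (x :+ y) :- (x′ :+ y′) := (x :- x′) :+ (y :- y′))
        refl (seq x n) (seq y n) (seq x′ n) (seq y′ n)))
    (double p q)) (x≈ ε ε>0 ∩ y≈ ε ε>0)
  where open +-*-Solver

neg-cong : ∀ {x x′} → x ≈ x′ → - x ≈ - x′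
neg-cong {x} {x′} x≈ ε ε>0 = eventually-map (λ {n} → subst (ℚ._≤ ε)
  (trans (∣∣-sym (seq x n) (seq x′ n)) (cong ℚ.∣_∣
    (solve 2 (λ x x′ → x′ :- x := :- x :- :- x′) refl (seq x n) (seq x′ n))))) (x≈ ε ε>0)
  where open +-*-Solver

-‿cong : ∀ {x x′ y y′} → x ≈ x′ → y ≈ y′ → x - y ≈ x′ - y′
-‿cong {x} {x′} {y} {y′} x≈ y≈ =
  +-cong {x} {x′} {(- y)} {(- y′)} x≈ (neg-cong {y} {y′} y≈)

∣∣-reverse : ∀ p q → ℚ.∣ p ∣ ℚ.- ℚ.∣ q ∣ ℚ.≤ ℚ.∣ p ℚ.- q ∣
∣∣-reverse p q = subst (ℚ.∣ p ∣ ℚ.- ℚ.∣ q ∣ ℚ.≤_)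
  (solve 2 (λ a b → (a :+ b) :- b := a) refl ℚ.∣ p ℚ.- q ∣ ℚ.∣ q ∣)
  (ℚ.+-monoˡ-≤ (ℚ.- ℚ.∣ q ∣) (∣∣-split p {p ℚ.- q} {q}
    (solve 2 (λ p q → p := (p :- q) :+ q) refl p q)))
  where open +-*-Solver

∣∣-cong : ∀ {x x′} → x ≈ x′ → ∣ x ∣ ≈ ∣ x′ ∣
∣∣-cong {x} {x′} x≈ ε ε>0 = eventually-map (λ {n} d≤ε → ℚ.≤-trans
  (∣∣≤ (∣∣-reverse (seq x n) (seq x′ n))
    (ℚ.≤-trans (ℚ.≤-reflexive
      (solve 2 (λ a b → :- (a :- b) := b :- a) refl ℚ.∣ seq x n ∣ ℚ.∣ seq x′ n ∣))
      (subst (ℚ.∣ seq x′ n ∣ ℚ.- ℚ.∣ seq x n ∣ ℚ.≤_) (∣∣-sym (seq x′ n) (seq x n))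
        (∣∣-reverse (seq x′ n) (seq x n))))) d≤ε) (x≈ ε ε>0)
  where open +-*-Solver

eventually-bounded : ∀ x → Σ[ B ∈ ℚ ] (ℚ.Positive B × Eventually (λ n → ℚ.∣ seq x n ∣ ℚ.≤ B))
eventually-bounded x =
  let N , close = cauchy x 1ℚ (ℚ.positive⁻¹ 1ℚ)
      a = seq x N
  in ℚ.∣ a ∣ ℚ.+ 1ℚ , ℚ.nonNeg+pos⇒pos ℚ.∣ a ∣ {{ℚ.∣-∣-nonNeg a}} 1ℚ , N , λ n N≤n →
    ℚ.≤-trans (∣∣-split (seq x n) {a} {seq x n ℚ.- a}
        (solve 2 (λ x a → x := a :+ (x :- a)) refl (seq x n) a))
      (ℚ.+-monoʳ-≤ ℚ.∣ a ∣ (close n N N≤n ℕ.≤-refl))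
  where open +-*-Solver

*-mono-∣∣ : ∀ p q {B ε} → .{{_ : ℚ.Positive B}} → ℚ.∣ p ∣ ℚ.≤ B → ℚ.∣ q ∣ ℚ.≤ ε →
  ℚ.∣ p ℚ.* q ∣ ℚ.≤ B ℚ.* ε
*-mono-∣∣ p q {B} {ε} p≤ q≤ = begin
  ℚ.∣ p ℚ.* q ∣          ≡⟨ ℚ.∣p*q∣≡∣p∣*∣q∣ p q ⟩
  ℚ.∣ p ∣ ℚ.* ℚ.∣ q ∣    ≤⟨ ℚ.*-monoʳ-≤-nonNeg ℚ.∣ q ∣ {{ℚ.∣-∣-nonNeg q}} p≤ ⟩
  B ℚ.* ℚ.∣ q ∣          ≤⟨ ℚ.*-monoˡ-≤-nonNeg B {{ℚ.pos⇒nonNeg B}} q≤ ⟩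
  B ℚ.* ε                ∎
  where open ℚ.≤-Reasoning

*-cong : ∀ {x x′ y y′} → x ≈ x′ → y ≈ y′ → x * y ≈ x′ * y′
*-cong {x} {x′} {y} {y′} x≈ y≈ =
  let B , B>0 , x≤B = eventually-bounded x
      C , C>0 , y′≤C = eventually-bounded y′
  in ≈-scaled {x * y} {x′ * y′} (B ℚ.+ C) {{ℚ.pos+pos⇒pos B {{B>0}} C {{C>0}}}} λ ε ε>0 →
    eventually-map (λ {n} (x≤ , y′≤ , dx , dy) → ℚ.≤-trans
      (∣∣-split (seq (x * y) n ℚ.- seq (x′ * y′) n)
        {seq x n ℚ.* (seq y n ℚ.- seq y′ n)} {seq y′ n ℚ.* (seq x n ℚ.- seq x′ n)}
        (solve 4 (λ x y x′ y′ → x :* y :- x′ :* y′ := x :* (y :- y′) :+ y′ :* (x :- x′))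
          refl (seq x n) (seq y n) (seq x′ n) (seq y′ n)))
      (ℚ.≤-trans (ℚ.+-mono-≤ (*-mono-∣∣ (seq x n) _ {{B>0}} x≤ dy)
          (*-mono-∣∣ (seq y′ n) _ {{C>0}} y′≤ dx))
        (ℚ.≤-reflexive (sym (ℚ.*-distribʳ-+ ε B C)))))
      (x≤B ∩ y′≤C ∩ x≈ ε ε>0 ∩ y≈ ε ε>0)
  where open +-*-Solver

-- Congruence for expressions and for the area.

infixl 6 _⊞_ _⊟_
infixl 7 _⊠_

-- Equality of reals is not propositional, so congruence is proved once for all
-- expressions.
data Expr (n : ℕ) : Set where
  var         : Fin n → Expr n
  con         : ℝ → Expr n
  _⊞_ _⊟_ _⊠_ : Expr n → Expr n → Expr n
  abs         : Expr n → Expr n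

⟦_⟧ᵉ : ∀ {n} → Expr n → Vector ℝ n → ℝ
⟦ var i ⟧ᵉ v = v i
⟦ con x ⟧ᵉ v = x
⟦ e ⊞ f ⟧ᵉ v = ⟦ e ⟧ᵉ v + ⟦ f ⟧ᵉ v
⟦ e ⊟ f ⟧ᵉ v = ⟦ e ⟧ᵉ v - ⟦ f ⟧ᵉ v
⟦ e ⊠ f ⟧ᵉ v = ⟦ e ⟧ᵉ v * ⟦ f ⟧ᵉ v
⟦ abs e ⟧ᵉ v = ∣ ⟦ e ⟧ᵉ v ∣

⟦⟧-cong : ∀ {n} (e : Expr n) {v w} → (∀ i → v i ≈ w i) → ⟦ e ⟧ᵉ v ≈ ⟦ e ⟧ᵉ w
⟦⟧-cong (var i) v≈ = v≈ i
⟦⟧-cong (con x) v≈ = ≈-refl {x}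
⟦⟧-cong (e ⊞ f) {v} {w} v≈ = +-cong {⟦ e ⟧ᵉ v} {⟦ e ⟧ᵉ w} {⟦ f ⟧ᵉ v} {⟦ f ⟧ᵉ w}
  (⟦⟧-cong e v≈) (⟦⟧-cong f v≈)
⟦⟧-cong (e ⊟ f) {v} {w} v≈ = -‿cong {⟦ e ⟧ᵉ v} {⟦ e ⟧ᵉ w} {⟦ f ⟧ᵉ v} {⟦ f ⟧ᵉ w}
  (⟦⟧-cong e v≈) (⟦⟧-cong f v≈)
⟦⟧-cong (e ⊠ f) {v} {w} v≈ = *-cong {⟦ e ⟧ᵉ v} {⟦ e ⟧ᵉ w} {⟦ f ⟧ᵉ v} {⟦ f ⟧ᵉ w}
  (⟦⟧-cong e v≈) (⟦⟧-cong f v≈)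
⟦⟧-cong (abs e) {v} {w} v≈ = ∣∣-cong {⟦ e ⟧ᵉ v} {⟦ e ⟧ᵉ w} (⟦⟧-cong e v≈)

area-cong : ∀ {A B : Triangle} → (∀ k → A k ≈ₚ B k) → area A ≈ area B
area-cong {A} {B} A≈B = ⟦⟧-cong areaExpr {coordinates A} {coordinates B} λ where
    0F → proj₁ (A≈B 0F)
    1F → proj₁ (A≈B 1F)
    2F → proj₁ (A≈B 2F)
    3F → proj₂ (A≈B 0F)
    4F → proj₂ (A≈B 1F)
    5F → proj₂ (A≈B 2F)
  where
  areaExpr : Expr 6
  areaExpr = con ½ℝ ⊠ abs ((var 1F ⊟ var 0F) ⊠ (var 5F ⊟ var 3F)
                         ⊟ (var 2F ⊟ var 0F) ⊠ (var 4F ⊟ var 3F))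
  coordinates : Triangle → Vector ℝ 6
  coordinates A = proj₁ (A 0F) ∷ proj₁ (A 1F) ∷ proj₁ (A 2F) ∷
                  proj₂ (A 0F) ∷ proj₂ (A 1F) ∷ proj₂ (A 2F) ∷ []

-- Invariance of the area under reordering of vertices and symmetries of the square.

cross : (X Y : Vector ℚ 3) (i j k : Fin 3) → ℚ
cross X Y i j k = (X j ℚ.- X i) ℚ.* (Y k ℚ.- Y i) ℚ.- (X k ℚ.- X i) ℚ.* (Y j ℚ.- Y i)

∣∣-neg : ∀ {p q} → p ≡ ℚ.- q → ℚ.∣ p ∣ ≡ ℚ.∣ q ∣
∣∣-neg {q = q} refl = ℚ.∣-p∣≡∣p∣ q

module _ (X Y : Vector ℚ 3) where

  open +-*-Solver using (solve; _:=_; _:+_; _:*_; _:-_; :-_; con)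

  ∣cross∣-swap₁ : ∀ i j k → ℚ.∣ cross X Y i j k ∣ ≡ ℚ.∣ cross X Y j i k ∣
  ∣cross∣-swap₁ i j k = ∣∣-neg (solve 6 (λ a b c d e f →
      (b :- a) :* (f :- d) :- (c :- a) :* (e :- d) :=
      :- ((a :- b) :* (f :- e) :- (c :- b) :* (d :- e)))
    refl (X i) (X j) (X k) (Y i) (Y j) (Y k))

  ∣cross∣-swap₂ : ∀ i j k → ℚ.∣ cross X Y i j k ∣ ≡ ℚ.∣ cross X Y i k j ∣
  ∣cross∣-swap₂ i j k = ∣∣-neg (solve 4 (λ a b c d → a :* b :- c :* d := :- (c :* d :- a :* b))
    refl (X j ℚ.- X i) (Y k ℚ.- Y i) (X k ℚ.- X i) (Y j ℚ.- Y i))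

  -- Two transpositions generate all orders, and each only changes the sign of `cross`, twice the
  -- signed area.
  ∣cross∣-permute : ∀ i j k → i ≢ j → i ≢ k → j ≢ k →
    ℚ.∣ cross X Y i j k ∣ ≡ ℚ.∣ cross X Y 0F 1F 2F ∣
  ∣cross∣-permute 0F 1F 2F _ _ _ = refl
  ∣cross∣-permute 0F 2F 1F _ _ _ = ∣cross∣-swap₂ 0F 2F 1F
  ∣cross∣-permute 1F 0F 2F _ _ _ = ∣cross∣-swap₁ 1F 0F 2F
  ∣cross∣-permute 1F 2F 0F _ _ _ = trans (∣cross∣-swap₂ 1F 2F 0F) (∣cross∣-swap₁ 1F 0F 2F)
  ∣cross∣-permute 2F 0F 1F _ _ _ = trans (∣cross∣-swap₁ 2F 0F 1F) (∣cross∣-swap₂ 0F 2F 1F)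
  ∣cross∣-permute 2F 1F 0F _ _ _ = trans (∣cross∣-swap₁ 2F 1F 0F)
    (trans (∣cross∣-swap₂ 1F 2F 0F) (∣cross∣-swap₁ 1F 0F 2F))
  ∣cross∣-permute 0F 0F _  i≢j _ _ = contradiction refl i≢j
  ∣cross∣-permute 1F 1F _  i≢j _ _ = contradiction refl i≢j
  ∣cross∣-permute 2F 2F _  i≢j _ _ = contradiction refl i≢j
  ∣cross∣-permute 0F 1F 0F _ i≢k _ = contradiction refl i≢k
  ∣cross∣-permute 0F 2F 0F _ i≢k _ = contradiction refl i≢k
  ∣cross∣-permute 1F 0F 1F _ i≢k _ = contradiction refl i≢k
  ∣cross∣-permute 1F 2F 1F _ i≢k _ = contradiction refl i≢k
  ∣cross∣-permute 2F 0F 2F _ i≢k _ = contradiction refl i≢k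
  ∣cross∣-permute 2F 1F 2F _ i≢k _ = contradiction refl i≢k
  ∣cross∣-permute 0F 1F 1F _ _ j≢k = contradiction refl j≢k
  ∣cross∣-permute 0F 2F 2F _ _ j≢k = contradiction refl j≢k
  ∣cross∣-permute 1F 0F 0F _ _ j≢k = contradiction refl j≢k
  ∣cross∣-permute 1F 2F 2F _ _ j≢k = contradiction refl j≢k
  ∣cross∣-permute 2F 0F 0F _ _ j≢k = contradiction refl j≢k
  ∣cross∣-permute 2F 1F 1F _ _ j≢k = contradiction refl j≢k

  ∣cross∣-exchange : ∀ i j k → ℚ.∣ cross Y X i j k ∣ ≡ ℚ.∣ cross X Y i j k ∣
  ∣cross∣-exchange i j k = ∣∣-neg (solve 4 (λ a b c d → a :* b :- c :* d := :- (d :* c :- b :* a))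
    refl (Y j ℚ.- Y i) (X k ℚ.- X i) (Y k ℚ.- Y i) (X j ℚ.- X i))

  ∣cross∣-flipX : ∀ i j k → ℚ.∣ cross (λ l → 1ℚ ℚ.- X l) Y i j k ∣ ≡ ℚ.∣ cross X Y i j k ∣
  ∣cross∣-flipX i j k = ∣∣-neg (solve 6 (λ a b c d e f →
      ((con 1ℚ :- b) :- (con 1ℚ :- a)) :* (f :- d) :- ((con 1ℚ :- c) :- (con 1ℚ :- a)) :* (e :- d) :=
      :- ((b :- a) :* (f :- d) :- (c :- a) :* (e :- d)))
    refl (X i) (X j) (X k) (Y i) (Y j) (Y k))

∣cross∣-flipY : ∀ X Y i j k → ℚ.∣ cross X (λ l → 1ℚ ℚ.- Y l) i j k ∣ ≡ ℚ.∣ cross X Y i j k ∣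
∣cross∣-flipY X Y i j k = trans (∣cross∣-exchange (λ l → 1ℚ ℚ.- Y l) X i j k)
  (trans (∣cross∣-flipX Y X i j k) (∣cross∣-exchange X Y i j k))

area-permute : ∀ (ρ : Permutation′ 3) (A : Triangle) → area (λ k → A (ρ ⟨$⟩ʳ k)) ≈ area A
area-permute ρ A = ≈-pointwise {area (λ k → A (ρ ⟨$⟩ʳ k))} {area A} λ n → cong (½ ℚ.*_)
  (∣cross∣-permute (λ k → seq (proj₁ (A k)) n) (λ k → seq (proj₂ (A k)) n)
    (ρ ⟨$⟩ʳ 0F) (ρ ⟨$⟩ʳ 1F) (ρ ⟨$⟩ʳ 2F)
    (distinct λ ()) (distinct λ ()) (distinct λ ()))
  where
  distinct : ∀ {i j} → i ≢ j → ρ ⟨$⟩ʳ i ≢ ρ ⟨$⟩ʳ j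
  distinct i≢j ρi≡ρj = i≢j (trans (sym (inverseˡ ρ)) (trans (cong (ρ ⟨$⟩ˡ_) ρi≡ρj) (inverseˡ ρ)))

flipIf : Bool → Vector ℚ 3 → Vector ℚ 3
flipIf b X k = if b then 1ℚ ℚ.- X k else X k

∣cross∣-flips : ∀ b c X Y i j k → ℚ.∣ cross (flipIf b X) (flipIf c Y) i j k ∣ ≡ ℚ.∣ cross X Y i j k ∣
∣cross∣-flips false false X Y i j k = refl
∣cross∣-flips false true  X Y i j k = ∣cross∣-flipY X Y i j k
∣cross∣-flips true  false X Y i j k = ∣cross∣-flipX X Y i j k
∣cross∣-flips true  true  X Y i j k =
  trans (∣cross∣-flipX X (flipIf true Y) i j k) (∣cross∣-flipY X Y i j k)

-- Holds term by term; splitting on the three Booleans lets `act` compute.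
area-act : ∀ σ (A : Triangle) → area (map (act σ) A) ≈ area A
area-act σ A = ≈-pointwise {area (map (act σ) A)} {area A} λ n → invariant n σ
  where
  module _ (n : ℕ) where
    X Y : Vector ℚ 3
    X k = seq (proj₁ (A k)) n
    Y k = seq (proj₂ (A k)) n
    invariant : ∀ σ → seq (area (map (act σ) A)) n ≡ seq (area A) n
    invariant record { swap = false ; flipX = false ; flipY = false } =
      cong (½ ℚ.*_) (∣cross∣-flips false false X Y 0F 1F 2F)
    invariant record { swap = false ; flipX = false ; flipY = true } =
      cong (½ ℚ.*_) (∣cross∣-flips false true X Y 0F 1F 2F)
    invariant record { swap = false ; flipX = true ; flipY = false } =
      cong (½ ℚ.*_) (∣cross∣-flips true false X Y 0F 1F 2F)
    invariant record { swap = false ; flipX = true ; flipY = true } =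
      cong (½ ℚ.*_) (∣cross∣-flips true true X Y 0F 1F 2F)
    invariant record { swap = true ; flipX = false ; flipY = false } =
      cong (½ ℚ.*_) (trans (∣cross∣-flips false false Y X 0F 1F 2F) (∣cross∣-exchange X Y 0F 1F 2F))
    invariant record { swap = true ; flipX = false ; flipY = true } =
      cong (½ ℚ.*_) (trans (∣cross∣-flips false true Y X 0F 1F 2F) (∣cross∣-exchange X Y 0F 1F 2F))
    invariant record { swap = true ; flipX = true ; flipY = false } =
      cong (½ ℚ.*_) (trans (∣cross∣-flips true false Y X 0F 1F 2F) (∣cross∣-exchange X Y 0F 1F 2F))
    invariant record { swap = true ; flipX = true ; flipY = true } =
      cong (½ ℚ.*_) (trans (∣cross∣-flips true true Y X 0F 1F 2F) (∣cross∣-exchange X Y 0F 1F 2F))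

area-△ : ∀ {A B : Triangle} → A ≈△ B → area A ≈ area B
area-△ {A} {B} (ρ , A≈B) = ≈-trans {area A} {area (λ k → B (ρ ⟨$⟩ʳ k))} {area B}
  (area-cong {A} {λ k → B (ρ ⟨$⟩ʳ k)} A≈B) (area-permute ρ B)

-- Areas of the cap and of the steps.

p≤q⇒0≤q-p : ∀ {p q} → p ℚ.≤ q → 0ℚ ℚ.≤ q ℚ.- p
p≤q⇒0≤q-p {p} {q} p≤q = subst (ℚ._≤ q ℚ.- p) (ℚ.+-inverseʳ p) (ℚ.+-monoˡ-≤ (ℚ.- p) p≤q)

+-nonNeg : ∀ {p q} → 0ℚ ℚ.≤ p → 0ℚ ℚ.≤ q → 0ℚ ℚ.≤ p ℚ.+ q
+-nonNeg = ℚ.+-mono-≤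

-- `1 - 2cz` is the vertical distance of the rails at abscissa `z`, so the product is twice the area
-- of a step, whichever rail carries its base.
stepProductℝ stepAreaℝ : (c w w′ z : ℝ) → ℝ
stepProductℝ c w w′ z = (w′ - w) * (1ℝ - 2ℝ * c * z)
stepAreaℝ c w w′ z = ½ℝ * stepProductℝ c w w′ z

sweptℝ : (c w z : ℝ) → ℝ
sweptℝ c w z = ½ℝ * (w + z) - c * w * z

stepAreaℝ-cong : ∀ c {w v w′ v′ z y} → w ≈ v → w′ ≈ v′ → z ≈ y →
  stepAreaℝ c w w′ z ≈ stepAreaℝ c v v′ y
stepAreaℝ-cong c {w} {v} {w′} {v′} {z} {y} w≈ w′≈ z≈ =
  ⟦⟧-cong (con ½ℝ ⊠ ((var 1F ⊟ var 0F) ⊠ (con 1ℝ ⊟ con 2ℝ ⊠ con c ⊠ var 2F)))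
    {w ∷ w′ ∷ z ∷ []} {v ∷ v′ ∷ y ∷ []} λ where
      0F → w≈
      1F → w′≈
      2F → z≈

-- A single term of `z` may exceed 1 by `ε`; the margin `ε` of `c` below `½` makes up for it. The
-- identity writes `1 - 2cz` as a sum of products of nonnegative numbers.
below-half : ∀ c z ε → 0ℚ ℚ.≤ ε → 0ℚ ℚ.≤ c → c ℚ.+ ε ℚ.≤ ½ → z ℚ.≤ 1ℚ ℚ.+ ε →
  0ℚ ℚ.≤ 1ℚ ℚ.- (1ℚ ℚ.+ 1ℚ) ℚ.* c ℚ.* z
below-half c z ε 0≤ε 0≤c c+ε≤½ z≤1+ε = subst (0ℚ ℚ.≤_)
  (solve 3 (λ c z ε → (c :+ c) :* (con 1ℚ :+ ε :- z)
      :+ ((con ½ :- (c :+ ε)) :* ((con 1ℚ :+ ε) :+ (con 1ℚ :+ ε)) :+ (ε :+ (ε :* ε :+ ε :* ε)))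
      := con 1ℚ :- (con 1ℚ :+ con 1ℚ) :* c :* z) refl c z ε)
  (+-nonNeg (*-nonNeg (+-nonNeg 0≤c 0≤c) (p≤q⇒0≤q-p z≤1+ε))
    (+-nonNeg (*-nonNeg (p≤q⇒0≤q-p c+ε≤½) (+-nonNeg 0≤1+ε 0≤1+ε))
      (+-nonNeg 0≤ε (+-nonNeg (*-nonNeg 0≤ε 0≤ε) (*-nonNeg 0≤ε 0≤ε)))))
  where
  open +-*-Solver hiding (var)
  0≤1+ε : 0ℚ ℚ.≤ 1ℚ ℚ.+ ε
  0≤1+ε = +-nonNeg (ℚ.nonNegative⁻¹ 1ℚ) 0≤ε

<⇒difference-nonNeg : ∀ {x y} → x < y → Eventually (λ n → 0ℚ ℚ.≤ seq y n ℚ.- seq x n)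
<⇒difference-nonNeg {x} {y} (ε , ε>0 , x+ε≤y) = eventually-map (λ {n} x+ε≤y →
  p≤q⇒0≤q-p (ℚ.≤-trans (ℚ.≤-trans (ℚ.≤-reflexive (sym (ℚ.+-identityʳ (seq x n))))
    (ℚ.+-monoʳ-≤ (seq x n) (ℚ.<⇒≤ ε>0))) x+ε≤y)) x+ε≤y

positive⇒nonNeg : ∀ {c} → 0ℝ < c → Eventually (λ n → 0ℚ ℚ.≤ seq c n)
positive⇒nonNeg {c} 0<c = eventually-map (λ {n} → subst (0ℚ ℚ.≤_) (ℚ.+-identityʳ (seq c n)))
  (<⇒difference-nonNeg {0ℝ} {c} 0<c)

stepProduct-nonNeg : ∀ {c w w′ z} → 0ℝ < c → c < ½ℝ → w < w′ → z ≤ 1ℝ →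
  Eventually (λ n → 0ℚ ℚ.≤ seq (stepProductℝ c w w′ z) n)
stepProduct-nonNeg {c} {w} {w′} {z} 0<c (ε , ε>0 , c+ε≤½) w<w′ z≤1 =
  eventually-map (λ {n} (0≤c , c+ε≤½ , 0≤w′-w , z≤1+ε) →
      *-nonNeg 0≤w′-w (below-half (seq c n) (seq z n) ε (ℚ.<⇒≤ ε>0) 0≤c c+ε≤½ z≤1+ε))
    -- The margin that witnesses `c < ½ℝ` also serves as the precision for `z ≤ 1ℝ`.
    (positive⇒nonNeg {c} 0<c ∩ c+ε≤½ ∩ <⇒difference-nonNeg {w} {w′} w<w′ ∩ z≤1 ε ε>0)

-- The sign of the terms of `r` is known only for large indices, so the absolute value disappears
-- only eventually; this suffices for `≈`.
area-signed : ∀ (A : Triangle) r →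
  let X = λ n k → seq (proj₁ (A k)) n ; Y = λ n k → seq (proj₂ (A k)) n in
  (∀ n → ℚ.∣ cross (X n) (Y n) 0F 1F 2F ∣ ≡ ℚ.∣ seq r n ∣) →
  Eventually (λ n → 0ℚ ℚ.≤ seq r n) → area A ≈ ½ℝ * r
area-signed A r same 0≤r = ≈-eventually {area A} {½ℝ * r}
  (eventually-map (λ {n} 0≤rₙ → cong (½ ℚ.*_) (trans (same n) (ℚ.0≤p⇒∣p∣≡p 0≤rₙ))) 0≤r)

cutArea : ℝ → Sign → (p u p′ u′ : ℝ) → ℝ
cutArea c Sign.- p u p′ u′ = stepAreaℝ c p p′ u
cutArea c Sign.+ p u p′ u′ = stepAreaℝ c u u′ p

cutTriangle : (lower upper : ℝ → Point) → Sign → (p u p′ u′ : ℝ) → Triangle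
cutTriangle lower upper Sign.- p u p′ u′ = lower p ∷ lower p′ ∷ upper u ∷ []
cutTriangle lower upper Sign.+ p u p′ u′ = lower p ∷ upper u ∷ upper u′ ∷ []

-- The case distinction in `zigZagTriangle` is local. With the direction as an argument it can be
-- analysed together with `Advance`.
zigZagTriangle-cut : ∀ lower upper {n} (Z : ZigZag n) i → let open ZigZag Z in
  zigZagTriangle lower upper Z i ≡
  cutTriangle lower upper (s i) (p (inject₁ i)) (u (inject₁ i)) (p (suc i)) (u (suc i))
zigZagTriangle-cut lower upper Z i with ZigZag.s Z i
... | Sign.- = refl
... | Sign.+ = refl

module _ (c : ℝ) (0<c : 0ℝ < c) (c<½ : c < ½ℝ) where

  open +-*-Solver hiding (var)

  lower upper : ℝ → Point
  lower = along P Q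
  upper = along S (R c)

  area-lower : ∀ p p′ u → p < p′ → u ≤ 1ℝ →
    area (lower p ∷ lower p′ ∷ upper u ∷ []) ≈ stepAreaℝ c p p′ u
  area-lower p p′ u p<p′ u≤1 = area-signed (lower p ∷ lower p′ ∷ upper u ∷ [])
    (stepProductℝ c p p′ u)
    (λ n → cong ℚ.∣_∣ (solve 4 (λ c p p′ u →
      let x = λ t → con 0ℚ :+ t :* (con 1ℚ :- con 0ℚ)
          y = λ t → con 0ℚ :+ t :* (con 0ℚ :- con 0ℚ)
          v = con 1ℚ :+ u :* ((con 1ℚ :- (con 1ℚ :+ con 1ℚ) :* c) :- con 1ℚ)
      in (x p′ :- x p) :* (v :- y p) :- (x u :- x p) :* (y p′ :- y p) :=
         (p′ :- p) :* (con 1ℚ :- (con 1ℚ :+ con 1ℚ) :* c :* u))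
      refl (seq c n) (seq p n) (seq p′ n) (seq u n)))
    (stepProduct-nonNeg {c} {p} {p′} {u} 0<c c<½ p<p′ u≤1)

  area-upper : ∀ p u u′ → u < u′ → p ≤ 1ℝ →
    area (lower p ∷ upper u ∷ upper u′ ∷ []) ≈ stepAreaℝ c u u′ p
  area-upper p u u′ u<u′ p≤1 = area-signed (lower p ∷ upper u ∷ upper u′ ∷ [])
    (stepProductℝ c u u′ p)
    -- These vertices run clockwise, so the determinant is the negative of the product.
    (λ n → ∣∣-neg (solve 4 (λ c p u u′ →
      let x = λ t → con 0ℚ :+ t :* (con 1ℚ :- con 0ℚ)
          y = λ t → con 0ℚ :+ t :* (con 0ℚ :- con 0ℚ)
          v = λ t → con 1ℚ :+ t :* ((con 1ℚ :- (con 1ℚ :+ con 1ℚ) :* c) :- con 1ℚ)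
      in (x u :- x p) :* (v u′ :- y p) :- (x u′ :- x p) :* (v u :- y p) :=
         :- ((u′ :- u) :* (con 1ℚ :- (con 1ℚ :+ con 1ℚ) :* c :* p)))
      refl (seq c n) (seq p n) (seq u n) (seq u′ n)))
    (stepProduct-nonNeg {c} {u} {u′} {p} 0<c c<½ u<u′ p≤1)

  area-cap : area (S ∷ T ∷ R c ∷ []) ≈ c
  area-cap = ≈-trans {area (S ∷ T ∷ R c ∷ [])} {½ℝ * (2ℝ * c)} {c}
    (area-signed (S ∷ T ∷ R c ∷ []) (2ℝ * c)
      (λ n → ∣∣-neg (solve 1 (λ c →
        (con 1ℚ :- con 0ℚ) :* ((con 1ℚ :- (con 1ℚ :+ con 1ℚ) :* c) :- con 1ℚ)
          :- (con 1ℚ :- con 0ℚ) :* (con 1ℚ :- con 1ℚ) :=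
        :- ((con 1ℚ :+ con 1ℚ) :* c)) refl (seq c n)))
      (eventually-map (*-nonNeg (ℚ.nonNegative⁻¹ (1ℚ ℚ.+ 1ℚ))) (positive⇒nonNeg {c} 0<c)))
    (≈-pointwise {½ℝ * (2ℝ * c)} {c} λ n →
      solve 1 (λ c → con ½ :* ((con 1ℚ :+ con 1ℚ) :* c) := c) refl (seq c n))

  area-cut : ∀ t p u p′ u′ → Advance t p u p′ u′ → p ≤ 1ℝ → u ≤ 1ℝ →
    area (cutTriangle lower upper t p u p′ u′) ≈ cutArea c t p u p′ u′
  area-cut Sign.- p u p′ u′ (p<p′ , _) _ u≤1 = area-lower p p′ u p<p′ u≤1
  area-cut Sign.+ p u p′ u′ (_ , u<u′) p≤1 _ = area-upper p u u′ u<u′ p≤1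

  area-zigZag : ∀ {n} (Z : ZigZag n) i → let open ZigZag Z in
    area (zigZagTriangle lower upper Z i) ≈
    cutArea c (s i) (p (inject₁ i)) (u (inject₁ i)) (p (suc i)) (u (suc i))
  area-zigZag Z i =
    subst (λ A → area A ≈ cutArea c (s i) (p (inject₁ i)) (u (inject₁ i)) (p (suc i)) (u (suc i)))
      (sym (zigZagTriangle-cut lower upper Z i))
      (area-cut (s i) (p (inject₁ i)) (u (inject₁ i)) (p (suc i)) (u (suc i)) (advance i)
        (proj₂ (p-onRail (inject₁ i))) (proj₂ (u-onRail (inject₁ i))))
    where open ZigZag Z

-- From zig-zags of reals to walks on rational terms.

swept-end : ∀ c {w z} → w ≈ 1ℝ → z ≈ 1ℝ → sweptℝ c w z ≈ 1ℝ - c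
swept-end c {w} {z} w≈ z≈ = ≈-trans {sweptℝ c w z} {sweptℝ c 1ℝ 1ℝ} {1ℝ - c}
  (⟦⟧-cong (con ½ℝ ⊠ (var 0F ⊞ var 1F) ⊟ con c ⊠ var 0F ⊠ var 1F)
    {w ∷ z ∷ []} {1ℝ ∷ 1ℝ ∷ []} λ { 0F → w≈ ; 1F → z≈ })
  (≈-pointwise {sweptℝ c 1ℝ 1ℝ} {1ℝ - c} λ n →
    Solver.solve 1 (λ c → Solver.con ½ Solver.:* (Solver.con 1ℚ Solver.:+ Solver.con 1ℚ)
        Solver.:- c Solver.:* Solver.con 1ℚ Solver.:* Solver.con 1ℚ Solver.:=
      Solver.con 1ℚ Solver.:- c) refl (seq c n))
  where module Solver = +-*-Solver

-- The end of a walk compares `2cw` with `2c` rather than `w` with 1, so that the error enters the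
-- last factor without being multiplied.
factor-end : ∀ c {w} → w ≈ 1ℝ → 2ℝ * c * w ≈ 2ℝ * c
factor-end c {w} w≈ = ≈-trans {2ℝ * c * w} {2ℝ * c * 1ℝ} {2ℝ * c}
  (*-cong {2ℝ * c} {2ℝ * c} {w} {1ℝ} (≈-refl {2ℝ * c}) w≈)
  (≈-pointwise {2ℝ * c * 1ℝ} {2ℝ * c} λ n → ℚ.*-identityʳ _)

-- In a zig-zag the rail point that stays does so only up to ≈, but a walk needs it
-- to stay exactly; hence the walk has its own current points w and z.
eventually-walk : ∀ {n} c (s : Vector Sign n) (p u : Vector ℝ (suc n)) (b : Vector ℝ n) w z →
  w ≈ p zero → z ≈ u zero →
  (∀ i → Advance (s i) (p (inject₁ i)) (u (inject₁ i)) (p (suc i)) (u (suc i))) →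
  p (fromℕ n) ≈ 1ℝ → u (fromℕ n) ≈ 1ℝ →
  (∀ i → b i ≈ cutArea c (s i) (p (inject₁ i)) (u (inject₁ i)) (p (suc i)) (u (suc i))) →
  ∀ ε → 0ℚ ℚ.< ε →
  Eventually (λ m → Walk (seq c m) ε (λ i → seq (b i) m) (seq w m) (seq z m))
eventually-walk {zero} c s p u b w z w≈ z≈ adv p≈1 u≈1 b≈ ε ε>0 =
  eventually-map (λ (e₁ , e₂ , e₃) → done e₁ e₂ e₃)
    (swept-end c {w} {z} w≈1 z≈1 ε ε>0 ∩ factor-end c {w} w≈1 ε ε>0 ∩ factor-end c {z} z≈1 ε ε>0)
  where
  w≈1 = ≈-trans {w} {p zero} {1ℝ} w≈ p≈1
  z≈1 = ≈-trans {z} {u zero} {1ℝ} z≈ u≈1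
eventually-walk {suc n} c s p u b w z w≈ z≈ adv p≈1 u≈1 b≈ ε ε>0 =
  step (s zero) (adv zero) (b≈ zero)
  where
  step : ∀ t → Advance t (p zero) (u zero) (p 1F) (u 1F) →
    head b ≈ cutArea c t (p zero) (u zero) (p 1F) (u 1F) →
    Eventually (λ m → Walk (seq c m) ε (λ i → seq (b i) m) (seq w m) (seq z m))
  step Sign.- (_ , u₁≈u₀) b₀≈ = eventually-map (λ {m} (e , v) → stepˡ (seq (p 1F) m) e v)
    (≈-trans {stepAreaℝ c w (p 1F) z} {stepAreaℝ c (p zero) (p 1F) (u zero)} {head b}
      (stepAreaℝ-cong c {w} {p zero} {p 1F} {p 1F} {z} {u zero} w≈ (≈-refl {p 1F}) z≈)
      (≈-sym {head b} {stepAreaℝ c (p zero) (p 1F) (u zero)} b₀≈) ε ε>0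
    ∩ eventually-walk c (tail s) (tail p) (tail u) (tail b) (p 1F) z (≈-refl {p 1F})
        (≈-trans {z} {u zero} {u 1F} z≈ (≈-sym {u 1F} {u zero} u₁≈u₀))
        (adv ∘ suc) p≈1 u≈1 (b≈ ∘ suc) ε ε>0)
  step Sign.+ (p₁≈p₀ , _) b₀≈ = eventually-map (λ {m} (e , v) → stepʳ (seq (u 1F) m) e v)
    (≈-trans {stepAreaℝ c z (u 1F) w} {stepAreaℝ c (u zero) (u 1F) (p zero)} {head b}
      (stepAreaℝ-cong c {z} {u zero} {u 1F} {u 1F} {w} {p zero} z≈ (≈-refl {u 1F}) w≈)
      (≈-sym {head b} {stepAreaℝ c (u zero) (u 1F) (p zero)} b₀≈) ε ε>0
    ∩ eventually-walk c (tail s) (tail p) (tail u) (tail b) w (u 1F)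
        (≈-trans {w} {p zero} {p 1F} w≈ (≈-sym {p 1F} {p zero} p₁≈p₀)) (≈-refl {u 1F})
        (adv ∘ suc) p≈1 u≈1 (b≈ ∘ suc) ε ε>0)

-- Maximum, minimum and range of the terms.

foldr-⊔-upper : ∀ {n} z (v : Vector ℝ n) m →
  seq z m ℚ.≤ seq (foldr _⊔_ z v) m × (∀ i → seq (v i) m ℚ.≤ seq (foldr _⊔_ z v) m)
foldr-⊔-upper {zero}  z v m = ℚ.≤-refl , λ ()
foldr-⊔-upper {suc n} z v m = ℚ.≤-trans z≤ ≤max , λ where
    zero    → ℚ.p≤p⊔q (seq (head v) m) _
    (suc i) → ℚ.≤-trans (v≤ i) ≤max
  where
  z≤ = proj₁ (foldr-⊔-upper z (tail v) m)
  v≤ = proj₂ (foldr-⊔-upper z (tail v) m)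
  ≤max = ℚ.p≤q⊔p (seq (head v) m) (seq (foldr _⊔_ z (tail v)) m)

foldr-⊓-lower : ∀ {n} z (v : Vector ℝ n) m →
  seq (foldr _⊓_ z v) m ℚ.≤ seq z m × (∀ i → seq (foldr _⊓_ z v) m ℚ.≤ seq (v i) m)
foldr-⊓-lower {zero}  z v m = ℚ.≤-refl , λ ()
foldr-⊓-lower {suc n} z v m = ℚ.≤-trans min≤ ≤z , λ where
    zero    → ℚ.p⊓q≤p (seq (head v) m) _
    (suc i) → ℚ.≤-trans min≤ (≤v i)
  where
  ≤z = proj₁ (foldr-⊓-lower z (tail v) m)
  ≤v = proj₂ (foldr-⊓-lower z (tail v) m)
  min≤ = ℚ.p⊓q≤q (seq (head v) m) (seq (foldr _⊓_ z (tail v)) m)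

≤max : ∀ {n} (v : Vector ℝ (suc n)) m i → seq (v i) m ℚ.≤ seq (max v) m
≤max v m zero    = proj₁ (foldr-⊔-upper (head v) (tail v) m)
≤max v m (suc i) = proj₂ (foldr-⊔-upper (head v) (tail v) m) i

min≤ : ∀ {n} (v : Vector ℝ (suc n)) m i → seq (min v) m ℚ.≤ seq (v i) m
min≤ v m zero    = proj₁ (foldr-⊓-lower (head v) (tail v) m)
min≤ v m (suc i) = proj₂ (foldr-⊓-lower (head v) (tail v) m) i

near-midpoint : ∀ {a b q} r → a ℚ.≤ q → q ℚ.≤ b → b ℚ.- a ℚ.≤ r ℚ.+ r →
  ℚ.∣ q ℚ.- ½ ℚ.* (a ℚ.+ b) ∣ ℚ.≤ r
near-midpoint {a} {b} {q} r a≤q q≤b b-a≤ = ∣∣≤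
  (ℚ.≤-trans (ℚ.+-monoˡ-≤ (ℚ.- (½ ℚ.* (a ℚ.+ b))) q≤b)
    (ℚ.≤-trans (ℚ.≤-reflexive (solve 2 (λ a b →
      b :- con ½ :* (a :+ b) := con ½ :* (b :- a)) refl a b)) half))
  (ℚ.≤-trans (ℚ.≤-reflexive (solve 2 (λ q g → :- (q :- g) := g :- q) refl q (½ ℚ.* (a ℚ.+ b))))
    (ℚ.≤-trans (ℚ.+-monoʳ-≤ (½ ℚ.* (a ℚ.+ b)) (ℚ.neg-antimono-≤ a≤q))
      (ℚ.≤-trans (ℚ.≤-reflexive (solve 2 (λ a b →
        con ½ :* (a :+ b) :- a := con ½ :* (b :- a)) refl a b)) half)))
  where
  open +-*-Solver
  half : ½ ℚ.* (b ℚ.- a) ℚ.≤ r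
  half = ℚ.≤-trans (ℚ.*-monoˡ-≤-nonNeg ½ b-a≤)
    (ℚ.≤-reflexive (solve 1 (λ r → con ½ :* (r :+ r) := r) refl r))

-- The midpoint between the extremes is within half the range of every term. It may vary with `m`,
-- since each index is refuted on its own.
concentrated : ∀ {n} (v : Vector ℝ (suc n)) r m → seq (max v - min v) m ℚ.≤ r ℚ.+ r →
  Σ[ γ ∈ ℚ ] (∀ i → ℚ.∣ seq (v i) m ℚ.- γ ∣ ℚ.≤ r)
concentrated v r m narrow = ½ ℚ.* (seq (min v) m ℚ.+ seq (max v) m) ,
  λ i → near-midpoint {seq (min v) m} {seq (max v) m} {seq (v i) m} r (min≤ v m i) (≤max v m i) narrow

-- Relabelling of the dissection, and the conclusion.

area-≈ᶠ : ∀ {n} σ (A B : Vector Triangle n) (A≈B : A ≈ᶠ map (map (act σ)) B) j →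
  area (A (proj₁ A≈B ⟨$⟩ˡ j)) ≈ area (B j)
area-≈ᶠ σ A B (π , A≈B) j = area-same (π ⟨$⟩ˡ j) j (inverseʳ π)
  where
  area-same : ∀ i j → π ⟨$⟩ʳ i ≡ j → area (A i) ≈ area (B j)
  area-same i j refl = ≈-trans {area (A i)} {area (map (act σ) (B j))} {area (B j)}
    (area-△ {A i} {map (act σ) (B j)} (A≈B i)) (area-act σ (B j))

-- `f` lists the triangles of `D` as the cap followed by the steps in order. The areas are those of
-- `D` itself, to which `areaRange` refers; they agree with the model only up to `≈`, hence the
-- errors `ε`.
eventually-cap-walk : ∀ {n} (D : Dissection (suc n)) → IsSingleCapTwoRail D → ∀ ε → 0ℚ ℚ.< ε →
  Σ[ c ∈ ℝ ] Σ[ f ∈ (Fin (suc n) → Fin (suc n)) ]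
    let b = λ i m → seq (area (triangle D (f i))) m in
    Eventually (λ m → ℚ.∣ seq c m ℚ.- b zero m ∣ ℚ.≤ ε ×
                      Walk (seq c m) ε (λ i → b (suc i) m) 0ℚ 0ℚ)
eventually-cap-walk {n} D (σ , c , Z , (0<c , c<½) , A≈B) ε ε>0 =
  c , proj₁ A≈B ⟨$⟩ˡ_ , cap≈ ∩ walks
  where
  open ZigZag Z
  b : Vector ℝ (suc n)
  b j = area (triangle D (proj₁ A≈B ⟨$⟩ˡ j))
  b≈ : ∀ j → b j ≈ area (capAndZigZag c Z j)
  b≈ = area-≈ᶠ σ (triangle D) (capAndZigZag c Z) A≈B
  cap≈ : Eventually (λ m → ℚ.∣ seq c m ℚ.- seq (b zero) m ∣ ℚ.≤ ε)
  cap≈ = ≈-sym {b zero} {c}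
    (≈-trans {b zero} {area (S ∷ T ∷ R c ∷ [])} {c} (b≈ zero) (area-cap c 0<c c<½)) ε ε>0
  walks : Eventually (λ m → Walk (seq c m) ε (λ i → seq (tail b i) m) 0ℚ 0ℚ)
  walks = eventually-walk c s p u (tail b) 0ℝ 0ℝ
    (≈-sym {p zero} {0ℝ} (proj₁ start)) (≈-sym {u zero} {0ℝ} (proj₂ start))
    advance (proj₁ finish) (proj₂ finish)
    (λ i → ≈-trans {b (suc i)} {area (zigZagTriangle (along P Q) (along S (R c)) Z i)}
      {cutArea c (s i) (p (inject₁ i)) (u (inject₁ i)) (p (suc i)) (u (suc i))}
      (b≈ (suc i)) (area-zigZag c 0<c c<½ Z i)) ε ε>0

η>0 : 0ℚ ℚ.< η
η>0 = ℚ.positive⁻¹ η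

-- Strict order of reals needs a rational gap as witness. Ranges up to `2ρ = 1/3300` are excluded,
-- which leaves this gap above `1/3500`.
excess : ℚ
excess = (ρ ℚ.+ ρ) ℚ.- + 1 / 3500

excess>0 : 0ℚ ℚ.< excess
excess>0 = toWitness {a? = 0ℚ ℚ.<? excess} _

proposition4 : (D : Dissection 9) → IsSingleCapTwoRail D → fromℚ (+ 1 / 3500) < areaRange D
proposition4 D h =
  let c , f , eventually = eventually-cap-walk D h η η>0
  -- `1/3500 + excess` evaluates to `ρ + ρ`, so a term of the range below it would put all areas
  -- within `ρ` of some `γ`.
  in excess , excess>0 , eventually-map (λ {m} (cap , walk) → ℚ.≮⇒≥ λ narrow →
    let γ , areas≈γ = concentrated (map area (triangle D)) ρ m (ℚ.<⇒≤ narrow)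
    in wide-range (λ i → seq (area (triangle D (f i))) m) cap (areas≈γ ∘ f) walk) eventually
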